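{- Let $\Gamma=\mathrm{Cay}(G,S)$ be one of the graphs $\mathcal{CGD}^1_{p^2}$ ($p=5$ or $5\mid p-1$), $\mathcal{CGD}^2_{p^2}$ ($5\mid p\pm1$), $\mathcal{CGD}_{p^3}$ ($p=5$ or $5\mid p-1$), $\mathcal{CGD}_{p^4}$ ($p$ any prime). Let $P$ be a Sylow $p$-subgroup of $R(G)$ and $A=\mathrm{Aut}(\Gamma)$. Then $\Gamma$ is $N_A(P)$-arc-transitive. Moreover: (1) If $\Gamma=\mathcal{CGD}^1_{p^2}$: for $p=5$, $N_A(R(GD_{5^2}))\cong R(GD_{5^2})\rtimes F_{20}$; for $5\mid p-1$, $N_A(R(GD_{p^2}))\cong R(GD_{p^2})\rtimes\mathbb{Z}_5$; and $|N_A(P)|\ne 20p^2$. (2) If $\Gamma=\mathcal{CGD}^2_{p^2}$: $N_A(R(GD_{p^2}))\cong R(GD_{p^2})\rtimes D_5$ and $20p^2$ divides $|N_A(P)|$. (3) If $\Gamma=\mathcal{CGD}_{p^3}$: for $p=5$, $N_A(R(GD_{5^3}))\cong R(GD_{5^3})\rtimes S_5$; for $5\mid p-1$, $R(GD_{p^3})\rtimes\mathbb{Z}_5\le N_A(R(GD_{p^3}))$. (4) If $\Gamma=\mathcal{CGD}_{p^4}$: $N_A(R(GD_{p^4}))\cong R(GD_{p^4})\rtimes S_5$.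
   Context: For a group $G$ and $S\subseteq G$ with $1\notin S=S^{ -1}$, $\mathrm{Cay}(G,S)$ has vertex set $G$ and edges $\{g,sg\}$; $R(G)\le\mathrm{Aut}(\mathrm{Cay}(G,S))$ is the right regular representation. For $H\le\mathrm{Aut}(\Gamma)$, $\Gamma$ is $H$-arc-transitive if $H$ is transitive on arcs. $N_A(X)$ denotes the normalizer in $A$. $D_5$ is dihedral of order 10, $F_{20}$ the Frobenius group of order 20. Exponents are computed in $\mathbb{Z}_p$. Let $\ell=1$ if $p=5$ and $\ell$ be an element of order 5 in $\mathbb{Z}_p^*$ if $5\mid p-1$. $GD_{p^2}=\langle a,d,h\mid a^p=d^p=h^2=[a,d]=1,\ h^{ -1}ah=a^{ -1},\ h^{ -1}dh=d^{ -1}\rangle$; $\mathcal{CGD}^1_{p^2}=\mathrm{Cay}(GD_{p^2},\{h,ah,a^{\ell(\ell+1)^{ -1}}d^{\ell^{ -1}}h,a^{\ell}d^{(\ell+1)^{ -1}}h,dh\})$; for $5\mid p\pm1$ and $\lambda\in\mathbb{Z}_p^*$ with $\lambda^2=5$, $\mathcal{CGD}^2_{p^2}=\mathrm{Cay}(GD_{p^2},\{h,ah,a^{2^{ -1}(1+\lambda)}dh,ad^{2^{ -1}(1+\lambda)}h,dh\})$. $GD_{p^3}=\langle a,b,d,h\rangle$, $a,b,d$ generating elementary abelian $\mathbb{Z}_p^3$, $h^2=1$, $h^{ -1}xh=x^{ -1}$ ($x=a,b,d$); $\mathcal{CGD}_{p^3}=\mathrm{Cay}(GD_{p^3},\{h,ah,bh,a^{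 -\ell^2}b^{ -\ell}d^{ -\ell^{ -1}}h,dh\})$. $GD_{p^4}=\langle a,b,c,d,h\rangle$, $a,b,c,d$ generating elementary abelian $\mathbb{Z}_p^4$, $h^2=1$, $h^{ -1}xh=x^{ -1}$; $\mathcal{CGD}_{p^4}=\mathrm{Cay}(GD_{p^4},\{h,ah,bh,ch,dh\})$. -}

module Defs where

open import Level using (0ℓ) renaming (suc to lsuc)
open import Data.Nat using (ℕ; zero; suc; _+_; _*_; _∸_; _^_; NonZero)
open import Data.Nat.DivMod using (_mod_; _%_)
open import Data.Nat.Divisibility using (_∣_)
open import Data.Fin using (Fin; toℕ) renaming (zero to fzero; suc to fsuc)
open import Data.Vec using (Vec; []; _∷_; zipWith; map; lookup)
open import Data.Bool using (Bool; true; false; if_then_else_; _xor_)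
open import Data.Sum using (_⊎_)
open import Data.Nat.Primality using (Prime)
open import Data.Product using (_×_; _,_; Σ; ∃; ∃-syntax)
open import Data.List using (List; []; _∷_)
open import Data.List.Membership.Propositional using (_∈_)
open import Relation.Binary.PropositionalEquality using (_≡_)
open import Relation.Nullary using (¬_)
open import Relation.Unary using (Pred; _⊆_)
open import Function.Bundles using (_↔_; Inverse)
open import Function.Construct.Composition using (_↔-∘_)
open import Function.Construct.Symmetry using (↔-sym)
open import Function.Construct.Identity using (↔-id)

zp : (p : ℕ) .{{_ : NonZero p}} → ℕ → Fin p
zp p x = x mod p

addZ : (p : ℕ) .{{_ : NonZero p}} → Fin p → Fin p → Fin p
addZ p x y = zp p (toℕ x + toℕ y)

mulZ : (p : ℕ) .{{_ : NonZero p}} → Fin p → Fin p → Fin p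
mulZ p x y = zp p (toℕ x * toℕ y)

negZ : (p : ℕ) .{{_ : NonZero p}} → Fin p → Fin p
negZ p x = zp p (p ∸ toℕ x)

-- natural-number representatives of -x and x^{-1} in Z_p
-- (x^{-1} = x^(p-2) by Fermat, valid for p prime and x ≢ 0 mod p)
negℕ : (p : ℕ) .{{_ : NonZero p}} → ℕ → ℕ
negℕ p x = p ∸ (x % p)

invℕ : ℕ → ℕ → ℕ
invℕ p x = x ^ (p ∸ 2)

-- The generalised dihedral group GD_{p^n} = Z_p^n ⋊ Z_2
-- (v , e) stands for  v h^e  with v ∈ Z_p^n written additively,
-- h inverting every element of Z_p^n.

GD : ℕ → ℕ → Set
GD n p = Vec (Fin p) n × Bool

gdMul : (n p : ℕ) .{{_ : NonZero p}} → GD n p → GD n p → GD n p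
gdMul n p (x , e) (y , f) =
  zipWith (addZ p) x (if e then map (negZ p) y else y) , e xor f

Adj : (n p : ℕ) .{{_ : NonZero p}} → List (GD n p) → GD n p → GD n p → Set
Adj n p S x y = ∃[ s ] (s ∈ S × y ≡ gdMul n p s x)

Perm : Set → Set
Perm X = X ↔ X

app : {X : Set} → Perm X → X → X
app σ = Inverse.to σ

_≈ₚ_ : {X : Set} → Perm X → Perm X → Set
σ ≈ₚ τ = ∀ x → app σ x ≡ app τ x

-- σ ∘ τ : first τ, then σ
_∘ₚ_ : {X : Set} → Perm X → Perm X → Perm X
σ ∘ₚ τ = σ ↔-∘ τ

idₚ : {X : Set} → Perm X
idₚ {X} = ↔-id X

_⁻¹ₚ : {X : Set} → Perm X → Perm X
σ ⁻¹ₚ = ↔-sym σ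

PermSet : Set → Set₁
PermSet X = Pred (Perm X) 0ℓ

record IsSubgroup {X : Set} (H : PermSet X) : Set where
  field
    respects : ∀ {σ τ} → σ ≈ₚ τ → H σ → H τ
    has-id   : H idₚ
    ∘-closed : ∀ {σ τ} → H σ → H τ → H (σ ∘ₚ τ)
    ⁻¹-closed : ∀ {σ} → H σ → H (σ ⁻¹ₚ)

HasSize : {X : Set} → PermSet X → ℕ → Set
HasSize {X} H k =
  Σ (Vec (Perm X) k) λ v →
    (∀ i → H (lookup v i)) ×
    (∀ i j → lookup v i ≈ₚ lookup v j → i ≡ j) ×
    (∀ σ → H σ → ∃[ i ] (σ ≈ₚ lookup v i))

Normalizer : {X : Set} → PermSet X → PermSet X → PermSet X
Normalizer A K σ = A σ × (∀ τ → (K τ → K ((σ ∘ₚ τ) ∘ₚ (σ ⁻¹ₚ))) × (K ((σ ∘ₚ τ) ∘ₚ (σ ⁻¹ₚ)) → K τ))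

IsSylow : {X : Set} → ℕ → PermSet X → PermSet X → Set
IsSylow p H P =
  IsSubgroup P × P ⊆ H ×
  ∃[ k ] ∃[ m ] (HasSize P (p ^ k) × HasSize H (p ^ k * m) × ¬ (p ∣ m))

Aut : (n p : ℕ) .{{_ : NonZero p}} → List (GD n p) → PermSet (GD n p)
Aut n p S σ = ∀ x y → (Adj n p S x y → Adj n p S (app σ x) (app σ y))
                    × (Adj n p S (app σ x) (app σ y) → Adj n p S x y)

RegRep : (n p : ℕ) .{{_ : NonZero p}} → PermSet (GD n p)
RegRep n p σ = ∃[ g ] (∀ x → app σ x ≡ gdMul n p x g)

ArcTransitive : (n p : ℕ) .{{_ : NonZero p}} → List (GD n p) → PermSet (GD n p) → Set
ArcTransitive n p S H =
  ∀ u v u' v' → Adj n p S u v → Adj n p S u' v' →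
  ∃[ σ ] (H σ × app σ u ≡ u' × app σ v ≡ v')

record Model : Set₁ where
  field
    Carrier : Set
    _≈_     : Carrier → Carrier → Set
    _∙_     : Carrier → Carrier → Carrier

open Model

record IsoTo {X : Set} (K : PermSet X) (M : Model) : Set where
  field
    f        : Carrier M → Perm X
    f-wd     : ∀ x y → _≈_ M x y → f x ≈ₚ f y
    f-inj    : ∀ x y → f x ≈ₚ f y → _≈_ M x y
    f-hom    : ∀ x y → f (_∙_ M x y) ≈ₚ (f x ∘ₚ f y)
    f-into   : ∀ x → K (f x)
    f-onto   : ∀ σ → K σ → ∃[ x ] (σ ≈ₚ f x)

Z5 : Model
Z5 = record { Carrier = Fin 5 ; _≈_ = _≡_ ; _∙_ = addZ 5 }

D5 : Model
D5 = record { Carrier = GD 1 5 ; _≈_ = _≡_ ; _∙_ = gdMul 1 5 }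

-- F_20 = AGL(1,5) = { x ↦ α x + β | α ∈ Z_5^* , β ∈ Z_5 };
-- (β , k) represents α = k+1, i.e. α = fsuc k
unit5 : Fin 5 → Fin 4
unit5 fzero    = fzero
unit5 (fsuc k) = k

F20 : Model
F20 = record
  { Carrier = Fin 5 × Fin 4
  ; _≈_ = _≡_
  ; _∙_ = λ { (β , k) (β' , k') →
              addZ 5 (mulZ 5 (fsuc k) β') β , unit5 (mulZ 5 (fsuc k) (fsuc k')) }
  }

S5 : Model
S5 = record { Carrier = Perm (Fin 5) ; _≈_ = _≈ₚ_ ; _∙_ = _∘ₚ_ }

ContainsSemidirect : (n p : ℕ) .{{_ : NonZero p}} → PermSet (GD n p) → Model → Set₁
ContainsSemidirect n p N M =
  ∃[ K ] (IsSubgroup K × K ⊆ N × IsoTo K M × RegRep n p ⊆ N ×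
          (∀ σ → K σ → RegRep n p σ → σ ≈ₚ idₚ))

IsSemidirect : (n p : ℕ) .{{_ : NonZero p}} → PermSet (GD n p) → Model → Set₁
IsSemidirect n p N M =
  ∃[ K ] (IsSubgroup K × K ⊆ N × IsoTo K M × RegRep n p ⊆ N ×
          (∀ σ → K σ → RegRep n p σ → σ ≈ₚ idₚ) ×
          (∀ σ → N σ → ∃[ ρ ] ∃[ κ ] (RegRep n p ρ × K κ × σ ≈ₚ (ρ ∘ₚ κ))))

ValidEll : (p : ℕ) .{{_ : NonZero p}} → ℕ → Set
ValidEll p ℓ = (p ≡ 5 × ℓ ≡ 1)
             ⊎ (5 ∣ p ∸ 1 × (ℓ ^ 5) % p ≡ 1 × ¬ (ℓ % p ≡ 1))

ValidLambda : (p : ℕ) .{{_ : NonZero p}} → ℕ → Set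
ValidLambda p λ′ = (5 ∣ p ∸ 1 ⊎ 5 ∣ p + 1) × (λ′ ^ 2) % p ≡ 5 % p × ¬ (λ′ % p ≡ 0)

-- a^i d^j h
e2 : (p : ℕ) .{{_ : NonZero p}} → ℕ → ℕ → GD 2 p
e2 p i j = (zp p i ∷ zp p j ∷ []) , true

-- a^i b^j d^k h
e3 : (p : ℕ) .{{_ : NonZero p}} → ℕ → ℕ → ℕ → GD 3 p
e3 p i j k = (zp p i ∷ zp p j ∷ zp p k ∷ []) , true

-- a^i b^j c^k d^m h
e4 : (p : ℕ) .{{_ : NonZero p}} → ℕ → ℕ → ℕ → ℕ → GD 4 p
e4 p i j k m = (zp p i ∷ zp p j ∷ zp p k ∷ zp p m ∷ []) , true

S-CGD1 : (p : ℕ) .{{_ : NonZero p}} → ℕ → List (GD 2 p)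
S-CGD1 p ℓ = e2 p 0 0 ∷ e2 p 1 0 ∷ e2 p (ℓ * invℕ p (ℓ + 1)) (invℕ p ℓ)
           ∷ e2 p ℓ (invℕ p (ℓ + 1)) ∷ e2 p 0 1 ∷ []

S-CGD2 : (p : ℕ) .{{_ : NonZero p}} → ℕ → List (GD 2 p)
S-CGD2 p λ′ = e2 p 0 0 ∷ e2 p 1 0 ∷ e2 p (invℕ p 2 * (1 + λ′)) 1
            ∷ e2 p 1 (invℕ p 2 * (1 + λ′)) ∷ e2 p 0 1 ∷ []

S-CGD3 : (p : ℕ) .{{_ : NonZero p}} → ℕ → List (GD 3 p)
S-CGD3 p ℓ = e3 p 0 0 0 ∷ e3 p 1 0 0 ∷ e3 p 0 1 0
           ∷ e3 p (negℕ p (ℓ ^ 2)) (negℕ p ℓ) (negℕ p (invℕ p ℓ)) ∷ e3 p 0 0 1 ∷ []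

S-CGD4 : (p : ℕ) .{{_ : NonZero p}} → List (GD 4 p)
S-CGD4 p = e4 p 0 0 0 0 ∷ e4 p 1 0 0 0 ∷ e4 p 0 1 0 0 ∷ e4 p 0 0 1 0 ∷ e4 p 0 0 0 1 ∷ []

NormArcTransitive : (n p : ℕ) .{{_ : NonZero p}} → List (GD n p) → Set₁
NormArcTransitive n p S =
  ∀ P → IsSylow p (RegRep n p) P → ArcTransitive n p S (Normalizer (Aut n p S) P)

NR : (n p : ℕ) .{{_ : NonZero p}} → List (GD n p) → PermSet (GD n p)
NR n p S = Normalizer (Aut n p S) (RegRep n p)

Part1 : Set₁
Part1 = ∀ (p : ℕ) .{{_ : NonZero p}} → Prime p → ∀ ℓ → ValidEll p ℓ →
  NormArcTransitive 2 p (S-CGD1 p ℓ) ×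
  (p ≡ 5 → IsSemidirect 2 p (NR 2 p (S-CGD1 p ℓ)) F20) ×
  (5 ∣ p ∸ 1 → IsSemidirect 2 p (NR 2 p (S-CGD1 p ℓ)) Z5) ×
  (∀ P → IsSylow p (RegRep 2 p) P →
     ¬ HasSize (Normalizer (Aut 2 p (S-CGD1 p ℓ)) P) (20 * p ^ 2))

Part2 : Set₁
Part2 = ∀ (p : ℕ) .{{_ : NonZero p}} → Prime p → ∀ λ′ → ValidLambda p λ′ →
  NormArcTransitive 2 p (S-CGD2 p λ′) ×
  IsSemidirect 2 p (NR 2 p (S-CGD2 p λ′)) D5 ×
  (∀ P → IsSylow p (RegRep 2 p) P →
     ∃[ k ] (HasSize (Normalizer (Aut 2 p (S-CGD2 p λ′)) P) k × 20 * p ^ 2 ∣ k))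

Part3 : Set₁
Part3 = ∀ (p : ℕ) .{{_ : NonZero p}} → Prime p → ∀ ℓ → ValidEll p ℓ →
  NormArcTransitive 3 p (S-CGD3 p ℓ) ×
  (p ≡ 5 → IsSemidirect 3 p (NR 3 p (S-CGD3 p ℓ)) S5) ×
  (5 ∣ p ∸ 1 → ContainsSemidirect 3 p (NR 3 p (S-CGD3 p ℓ)) Z5)

Part4 : Set₁
Part4 = ∀ (p : ℕ) .{{_ : NonZero p}} → Prime p →
  NormArcTransitive 4 p (S-CGD4 p) ×
  IsSemidirect 4 p (NR 4 p (S-CGD4 p)) S5

-- Idea. Write V for ℤ_p^n and w 0 = 0, …, w 4 for the vectors with S = { (w i) h }. A graph automorphism σ that
-- conjugates translations by V to translations by V becomes, after composition with a right translation, a map fixing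
-- 1; it is then additive on V and permutes S, so it is (v , h^e) ↦ (L v + e · w (π 0) , h^e) for the permutation π
-- induced on the indices, with L linear and L (w i) + w (π 0) = w (π i). As some of the w i are 0 and a basis of V,
-- π determines L. A σ normalising R(G) satisfies the assumption on V because 0 and a basis vector have a common
-- neighbour. A Sylow p-subgroup of R(G) is the group of translations by V, or R(G) itself if p = 2. Hence all the
-- normalisers in question are the products of R(G) and the group of those permutations of the five points that extend
-- to affine maps.
--
-- For the graph of order 2p⁴ every permutation of the points extends. For the others the w i have coordinates in ℤ[ζ]
-- (ζ⁵ = 1) or ℤ[φ] (φ² = φ + 1), where it is checked exactly, hence for all p at once, that the asserted permutations
-- extend; for the graphs of order 2p² every other permutation leaves an error whose norm is, up to sign, a power of 5,
-- so the error stays nonzero in ℤ_p for p ≠ 5. The case p = 5 is a finite computation in ℤ_5.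
module Submission where

open import Defs
open import Algebra.Bundles using (CommutativeRing; Group; AbelianGroup)
import Algebra.Properties.AbelianGroup as AbelianGroupProperties
import Algebra.Properties.CommutativeMonoid.Sum as MonoidSum
import Algebra.Properties.Group as GroupProperties
import Algebra.Properties.Ring as RingProperties
open import Algebra.Structures using (IsCommutativeRing; IsAbelianGroup)
open import Data.Bool using (Bool; true; false; _xor_; not; if_then_else_)
open import Data.Bool.Properties using (not-involutive; not-injective; xor-comm) renaming (_≟_ to _≟ᵇ_)
open import Data.Fin using (Fin; toℕ; punchOut) renaming (zero to fzero; suc to fsuc)
open import Data.Fin.Patterns using (0F; 1F; 2F; 3F; 4F)
open import Data.Fin.Properties using (toℕ-fromℕ<; toℕ-injective; toℕ<n; any?; punchOut-injective; punchIn-punchOut; injective⇒≤; suc-injective; all?; *↔×; 2↔Bool) renaming (_≟_ to _≟ᶠ_)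
open import Data.Integer as ℤ using (ℤ; +_; -[1+_]; 0ℤ; 1ℤ; ∣_∣)
import Data.Integer.Properties as ℤₚ
open import Data.List using (List; []; _∷_; foldr)
open import Data.List.Membership.Propositional using (_∈_)
open import Data.List.Relation.Unary.Any as Any using (here; there; Any)
open import Data.Maybe using (nothing)
open import Data.Nat as ℕ using (ℕ; zero; suc; _∸_; _^_; NonZero; _≤_; _<_)
open import Data.Nat.DivMod using (_%_; m%n<n; %-distribˡ-+; %-distribˡ-*; m<n⇒m%n≡m; n%n≡0)
open import Data.Nat.Divisibility using (_∣_; _∣0; m%n≡0⇒n∣m; n∣m⇒m%n≡0; ∣1⇒≡1; ∣⇒≤; divides; m∣m*n; ∣m⇒∣m*n; _∣?_; ∣-trans)
open import Data.Nat.Primality using (Prime; euclidsLemma; ¬prime[1]; ¬prime[0]; prime[2]; prime⇒nonTrivial; prime⇒irreducible; prime?)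
import Data.Nat.Properties as ℕₚ
import Data.Nat.Tactic.RingSolver as ℕSolver
open import Data.Product using (_×_; _,_; ∃; proj₁; proj₂)
open import Data.Product.Function.NonDependent.Propositional using (_×-↔_)
open import Data.Sum as Sum using (_⊎_; inj₁; inj₂; [_,_]′)
open import Data.Vec using (Vec; []; _∷_; zipWith; map; replicate; lookup; tabulate; uncons; head; tail)
import Data.Vec.Properties as Vecₚ
import Data.Vec.Relation.Unary.Any as VecAny
open import Function using (_∘_; id)
open import Function.Bundles using (_↔_; Inverse; mk↔ₛ′)
open import Function.Construct.Composition using (_↔-∘_)
open import Function.Construct.Identity using (↔-id)
open import Function.Definitions using (Injective)
open import Level using (0ℓ)
open import Relation.Binary.PropositionalEquality hiding ([_])
open import Relation.Nullary using (¬_; yes; no; contradiction; Dec)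
open import Relation.Nullary.Decidable using (_×-dec_; from-yes; map′; _⊎-dec_; _→-dec_; ¬?; from-no)
open import Tactic.RingSolver.Core.AlmostCommutativeRing using (fromCommutativeRing)
import Tactic.RingSolver.NonReflective as RingSolver

-- Injective self-maps of finite sets.

-- If `y` were missed, removing it from the codomain would give an injection into a smaller finite
-- set.
injective⇒surjective : ∀ {n} {f : Fin n → Fin n} → Injective _≡_ _≡_ f → ∀ y → ∃ λ x → f x ≡ y
injective⇒surjective {suc n} {f} f-inj y with any? (λ x → f x ≟ᶠ y)
... | yes hit = hit
... | no miss = contradiction
  (injective⇒≤ {f = λ x → punchOut (y≢f x)} λ {x} {x'} eq → f-inj (punchOut-injective (y≢f x) (y≢f x') eq))
  ℕₚ.1+n≰n
  where
  y≢f : ∀ x → y ≢ f x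
  y≢f x y≡fx = miss (x , sym y≡fx)

injective⇒↔ : ∀ {n} {f : Fin n → Fin n} → Injective _≡_ _≡_ f → Fin n ↔ Fin n
injective⇒↔ {f = f} f-inj = mk↔ₛ′ f (proj₁ ∘ onto) (proj₂ ∘ onto) (λ x → f-inj (proj₂ (onto (f x))))
  where onto = injective⇒surjective f-inj

↔-injective : ∀ {X Y : Set} (σ : X ↔ Y) {x y} → Inverse.to σ x ≡ Inverse.to σ y → x ≡ y
↔-injective σ {x} {y} eq = trans (sym (Inverse.strictlyInverseʳ σ x)) (trans (cong (Inverse.from σ) eq) (Inverse.strictlyInverseʳ σ y))

-- The ring ℤ_p, without zero divisors for prime p.

module Residues (p : ℕ) .{{p≢0 : NonZero p}} where

  infixl 6 _⊕_
  infixl 7 _⊗_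

  _⊕_ _⊗_ : Fin p → Fin p → Fin p
  _⊕_ = addZ p
  _⊗_ = mulZ p

  [_] : ℕ → Fin p
  [_] = zp p

  toℕ-zp : ∀ x → toℕ [ x ] ≡ x % p
  toℕ-zp x = toℕ-fromℕ< (m%n<n x p)

  zp-cong : ∀ {x y} → x % p ≡ y % p → [ x ] ≡ [ y ]
  zp-cong {x} {y} eq = toℕ-injective (trans (toℕ-zp x) (trans eq (sym (toℕ-zp y))))

  zp-injective : ∀ {x y} → [ x ] ≡ [ y ] → x % p ≡ y % p
  zp-injective {x} {y} eq = trans (sym (toℕ-zp x)) (trans (cong toℕ eq) (toℕ-zp y))

  zp-toℕ : ∀ i → [ toℕ i ] ≡ i
  zp-toℕ i = toℕ-injective (trans (toℕ-zp (toℕ i)) (m<n⇒m%n≡m (toℕ<n i)))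

  zp-+ : ∀ x y → [ x ] ⊕ [ y ] ≡ [ x ℕ.+ y ]
  zp-+ x y = zp-cong (trans (cong₂ (λ a b → (a ℕ.+ b) % p) (toℕ-zp x) (toℕ-zp y)) (sym (%-distribˡ-+ x y p)))

  zp-* : ∀ x y → [ x ] ⊗ [ y ] ≡ [ x ℕ.* y ]
  zp-* x y = zp-cong (trans (cong₂ (λ a b → (a ℕ.* b) % p) (toℕ-zp x) (toℕ-zp y)) (sym (%-distribˡ-* x y p)))

  -- Replacing residues by representatives `[ a ]` reduces the ring laws below to laws of natural
  -- numbers.
  zp-surjective : ∀ x → ∃ λ a → x ≡ [ a ]
  zp-surjective x = toℕ x , sym (zp-toℕ x)

  zp-p : [ p ] ≡ [ 0 ]
  zp-p = zp-cong (trans (n%n≡0 p) (sym (n∣m⇒m%n≡0 0 p (p ∣0))))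

  zp≡0⇒∣ : ∀ {x} → [ x ] ≡ [ 0 ] → p ∣ x
  zp≡0⇒∣ {x} eq = m%n≡0⇒n∣m x p (trans (zp-injective eq) (n∣m⇒m%n≡0 0 p (p ∣0)))

  ∣⇒zp≡0 : ∀ {x} → p ∣ x → [ x ] ≡ [ 0 ]
  ∣⇒zp≡0 {x} p∣x = zp-cong (trans (n∣m⇒m%n≡0 x p p∣x) (sym (n∣m⇒m%n≡0 0 p (p ∣0))))

  ⊕-assoc : ∀ x y z → (x ⊕ y) ⊕ z ≡ x ⊕ (y ⊕ z)
  ⊕-assoc x y z with zp-surjective x | zp-surjective y | zp-surjective z
  ... | a , refl | b , refl | c , refl
    rewrite zp-+ a b | zp-+ b c | zp-+ (a ℕ.+ b) c | zp-+ a (b ℕ.+ c) | ℕₚ.+-assoc a b c = refl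

  ⊕-comm : ∀ x y → x ⊕ y ≡ y ⊕ x
  ⊕-comm x y = cong [_] (ℕₚ.+-comm (toℕ x) (toℕ y))

  ⊕-identityˡ : ∀ x → [ 0 ] ⊕ x ≡ x
  ⊕-identityˡ x with zp-surjective x
  ... | a , refl = zp-+ 0 a

  ⊕-inverseˡ : ∀ x → negZ p x ⊕ x ≡ [ 0 ]
  ⊕-inverseˡ x = begin
    [ p ∸ toℕ x ] ⊕ x            ≡⟨ cong ([ p ∸ toℕ x ] ⊕_) (zp-toℕ x) ⟨
    [ p ∸ toℕ x ] ⊕ [ toℕ x ]    ≡⟨ zp-+ (p ∸ toℕ x) (toℕ x) ⟩
    [ p ∸ toℕ x ℕ.+ toℕ x ]      ≡⟨ cong [_] (ℕₚ.m∸n+n≡m (ℕₚ.<⇒≤ (toℕ<n x))) ⟩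
    [ p ]                        ≡⟨ zp-p ⟩
    [ 0 ]                        ∎
    where open ≡-Reasoning

  ⊗-assoc : ∀ x y z → (x ⊗ y) ⊗ z ≡ x ⊗ (y ⊗ z)
  ⊗-assoc x y z with zp-surjective x | zp-surjective y | zp-surjective z
  ... | a , refl | b , refl | c , refl
    rewrite zp-* a b | zp-* b c | zp-* (a ℕ.* b) c | zp-* a (b ℕ.* c) | ℕₚ.*-assoc a b c = refl

  ⊗-comm : ∀ x y → x ⊗ y ≡ y ⊗ x
  ⊗-comm x y = cong [_] (ℕₚ.*-comm (toℕ x) (toℕ y))

  ⊗-identityˡ : ∀ x → [ 1 ] ⊗ x ≡ x
  ⊗-identityˡ x with zp-surjective x
  ... | a , refl = trans (zp-* 1 a) (cong [_] (ℕₚ.*-identityˡ a))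

  ⊗-distribˡ-⊕ : ∀ x y z → x ⊗ (y ⊕ z) ≡ x ⊗ y ⊕ x ⊗ z
  ⊗-distribˡ-⊕ x y z with zp-surjective x | zp-surjective y | zp-surjective z
  ... | a , refl | b , refl | c , refl
    rewrite zp-+ b c | zp-* a b | zp-* a c | zp-* a (b ℕ.+ c) | zp-+ (a ℕ.* b) (a ℕ.* c) | ℕₚ.*-distribˡ-+ a b c = refl

  ⊕-⊗-isCommutativeRing : IsCommutativeRing _≡_ _⊕_ _⊗_ (negZ p) [ 0 ] [ 1 ]
  ⊕-⊗-isCommutativeRing = record
    { isRing = record
      { +-isAbelianGroup = record
        { isGroup = record
          { isMonoid = record
            { isSemigroup = record
              { isMagma = record { isEquivalence = isEquivalence ; ∙-cong = cong₂ _⊕_ }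
              ; assoc = ⊕-assoc }
            ; identity = ⊕-identityˡ , (λ x → trans (⊕-comm x [ 0 ]) (⊕-identityˡ x)) }
          ; inverse = ⊕-inverseˡ , (λ x → trans (⊕-comm x (negZ p x)) (⊕-inverseˡ x))
          ; ⁻¹-cong = cong (negZ p) }
        ; comm = ⊕-comm }
      ; *-cong = cong₂ _⊗_
      ; *-assoc = ⊗-assoc
      ; *-identity = ⊗-identityˡ , (λ x → trans (⊗-comm x [ 1 ]) (⊗-identityˡ x))
      ; distrib = ⊗-distribˡ-⊕ ,
          (λ x y z → trans (⊗-comm (y ⊕ z) x)
            (trans (⊗-distribˡ-⊕ x y z) (cong₂ _⊕_ (⊗-comm x y) (⊗-comm x z)))) }
    ; *-comm = ⊗-comm }

  ℤ/p : CommutativeRing 0ℓ 0ℓ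
  ℤ/p = record { isCommutativeRing = ⊕-⊗-isCommutativeRing }

  open CommutativeRing ℤ/p public
    using (ring; +-identityʳ; -‿inverseʳ; *-identityʳ; distribʳ; zeroˡ; zeroʳ)
  open RingProperties ring public
    using (-‿distribˡ-*; -‿distribʳ-*; -‿involutive; x∙y⁻¹≈ε⇒x≈y; -0#≈0#; -‿+-comm; +-cancelˡ)

  module _ (pr : Prime p) where

    1≢0 : [ 1 ] ≢ [ 0 ]
    1≢0 eq = ¬prime[1] (subst Prime (∣1⇒≡1 (zp≡0⇒∣ eq)) pr)

    integral : ∀ {x y} → x ⊗ y ≡ [ 0 ] → x ≡ [ 0 ] ⊎ y ≡ [ 0 ]
    integral {x} {y} eq with euclidsLemma (toℕ x) (toℕ y) pr (zp≡0⇒∣ eq)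
    ... | inj₁ p∣x = inj₁ (trans (sym (zp-toℕ x)) (∣⇒zp≡0 p∣x))
    ... | inj₂ p∣y = inj₂ (trans (sym (zp-toℕ y)) (∣⇒zp≡0 p∣y))

    ⊗-cancelˡ : ∀ x {y z} → x ≢ [ 0 ] → x ⊗ y ≡ x ⊗ z → y ≡ z
    ⊗-cancelˡ x {y} {z} x≢0 eq = x∙y⁻¹≈ε⇒x≈y y z ([ (λ e → contradiction e x≢0) , id ]′ (integral x[y-z]≡0))
      where
      open ≡-Reasoning
      x[y-z]≡0 : x ⊗ (y ⊕ negZ p z) ≡ [ 0 ]
      x[y-z]≡0 = begin
        x ⊗ (y ⊕ negZ p z)        ≡⟨ ⊗-distribˡ-⊕ x y (negZ p z) ⟩
        x ⊗ y ⊕ x ⊗ negZ p z      ≡⟨ cong₂ _⊕_ eq (trans (⊗-comm x _) (trans (sym (-‿distribˡ-* z x)) (cong (negZ p) (⊗-comm z x)))) ⟩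
        x ⊗ z ⊕ negZ p (x ⊗ z)    ≡⟨ -‿inverseʳ (x ⊗ z) ⟩
        [ 0 ]                     ∎

-- Fermat's little theorem and inverses modulo p.

module _ where
  open Residues

  -- Multiplication by x permutes the nonzero residues, so it does not change their product.
  fermat : ∀ p .{{_ : NonZero p}} → Prime p → ∀ x → zp p x ≢ zp p 0 → zp p (x ^ (p ∸ 1)) ≡ zp p 1
  fermat p@(suc q) pr x x≢0 = sym (⊗-cancelˡ p pr Π Π≢0 (begin
    Π ⊗' [1]                                 ≡⟨ CommutativeRing.*-identityʳ (ℤ/p p) Π ⟩
    Π                                        ≡⟨ ΠM.sum-permute fsuc (injective⇒↔ mul-injective) ⟩
    ΠM.sum (λ i → fsuc (mul i))              ≡⟨ ΠM.sum-cong-≗ suc-mul ⟩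
    ΠM.sum (λ i → x̄ ⊗' fsuc i)               ≡⟨ ΠM.∑-distrib-+ (λ _ → x̄) fsuc ⟩
    ΠM.sum (λ (_ : Fin q) → x̄) ⊗' Π          ≡⟨ cong (_⊗' Π) (power q) ⟩
    zp p (x ^ q) ⊗' Π                        ≡⟨ ⊗-comm p (zp p (x ^ q)) Π ⟩
    Π ⊗' zp p (x ^ q)                        ∎))
    where
    open ≡-Reasoning
    module ΠM = MonoidSum (CommutativeRing.*-commutativeMonoid (ℤ/p p))
    infixl 7 _⊗'_
    _⊗'_ = mulZ p
    [1] = zp p 1
    x̄ = zp p x
    -- Over the multiplicative monoid `sum` is a product, and as `p` is `suc q` the `fsuc i` are
    -- exactly the nonzero residues.
    Π = ΠM.sum {q} fsuc
    nonzero : ∀ i → fzero ≢ x̄ ⊗' fsuc i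
    nonzero i eq with integral p pr {x̄} {fsuc i} (sym eq)
    ... | inj₁ x≡0 = x≢0 x≡0
    ... | inj₂ ()
    mul : Fin q → Fin q
    mul i = punchOut (nonzero i)
    suc-mul : ∀ i → fsuc (mul i) ≡ x̄ ⊗' fsuc i
    suc-mul i = punchIn-punchOut (nonzero i)
    mul-injective : Injective _≡_ _≡_ mul
    mul-injective {i} {j} eq = suc-injective (⊗-cancelˡ p pr x̄ x≢0
      (trans (sym (suc-mul i)) (trans (cong fsuc eq) (suc-mul j))))
    power : ∀ k → ΠM.sum (λ (_ : Fin k) → x̄) ≡ zp p (x ^ k)
    power zero    = refl
    power (suc k) = trans (cong (x̄ ⊗'_) (power k)) (zp-* p x (x ^ k))
    product≢0 : ∀ k (f : Fin k → Fin q) → ΠM.sum (λ i → fsuc (f i)) ≢ fzero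
    product≢0 zero    f eq = 1≢0 p pr eq
    product≢0 (suc k) f eq with integral p pr {fsuc (f fzero)} eq
    ... | inj₁ ()
    ... | inj₂ e = product≢0 k (f ∘ fsuc) e
    Π≢0 : Π ≢ fzero
    Π≢0 = product≢0 q id

  -- For `p = suc (suc q)` the product `x * x ^ q` is by definition `x ^ (p ∸ 1)`, so Fermat
  -- applies; primality excludes the cases 0 and 1, where `p ∸ 2` is truncated.
  invℕ-inverse : ∀ p .{{_ : NonZero p}} → Prime p → ∀ x → zp p x ≢ zp p 0 → mulZ p (zp p x) (zp p (invℕ p x)) ≡ zp p 1
  invℕ-inverse zero          pr x x≢0 = contradiction pr ¬prime[0]
  invℕ-inverse (suc zero)    pr x x≢0 = contradiction pr ¬prime[1]
  invℕ-inverse (suc (suc q)) pr x x≢0 = trans (zp-* _ x (x ^ q)) (fermat (suc (suc q)) pr x x≢0)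

-- Vectors over ℤ_p and additive maps.

module Vectors (p : ℕ) .{{p≢0 : NonZero p}} where
  open Residues p

  infixl 6 _+ᵥ_ _⊖_
  infixl 7 _·_
  infix  8 -ᵥ_

  V : ℕ → Set
  V n = Vec (Fin p) n

  _+ᵥ_ : ∀ {n} → V n → V n → V n
  _+ᵥ_ = zipWith (addZ p)

  -ᵥ_ : ∀ {n} → V n → V n
  -ᵥ_ = map (negZ p)

  _⊖_ : ∀ {n} → V n → V n → V n
  u ⊖ v = u +ᵥ -ᵥ v

  0ᵥ : ∀ {n} → V n
  0ᵥ {n} = replicate n (zp p 0)

  _·_ : ∀ {n} → Fin p → V n → V n
  x · v = map (mulZ p x) v

  unit : ∀ {n} → Fin n → V n
  unit fzero    = zp p 1 ∷ 0ᵥ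
  unit (fsuc j) = zp p 0 ∷ unit j

  +ᵥ-isAbelianGroup : ∀ {n} → IsAbelianGroup _≡_ (_+ᵥ_ {n}) 0ᵥ -ᵥ_
  +ᵥ-isAbelianGroup = record
    { isGroup = record
      { isMonoid = record
        { isSemigroup = record
          { isMagma = record { isEquivalence = isEquivalence ; ∙-cong = cong₂ _+ᵥ_ }
          ; assoc = Vecₚ.zipWith-assoc ⊕-assoc }
        ; identity = Vecₚ.zipWith-identityˡ ⊕-identityˡ , Vecₚ.zipWith-identityʳ +-identityʳ }
      ; inverse = Vecₚ.zipWith-inverseˡ ⊕-inverseˡ , Vecₚ.zipWith-inverseʳ -‿inverseʳ
      ; ⁻¹-cong = cong -ᵥ_ }
    ; comm = Vecₚ.zipWith-comm ⊕-comm }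

  +ᵥ-abelianGroup : ℕ → AbelianGroup 0ℓ 0ℓ
  +ᵥ-abelianGroup n = record { isAbelianGroup = +ᵥ-isAbelianGroup {n} }

  module _ {n : ℕ} where
    open AbelianGroup (+ᵥ-abelianGroup n) public
      using () renaming (assoc to +ᵥ-assoc; comm to +ᵥ-comm; identityˡ to +ᵥ-identityˡ; identityʳ to +ᵥ-identityʳ;
                         inverseˡ to +ᵥ-inverseˡ; inverseʳ to +ᵥ-inverseʳ)
    open AbelianGroupProperties (+ᵥ-abelianGroup n) public
      using () renaming (⁻¹-involutive to -ᵥ-involutive; ε⁻¹≈ε to -ᵥ-0;
                         identityʳ-unique to +ᵥ-identityʳ-unique; inverseʳ-unique to -ᵥ-unique; ⁻¹-∙-comm to -ᵥ-+ᵥ)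

    open ≡-Reasoning

    ⊖-+ᵥ-cancel : ∀ (x y : V n) → (x ⊖ y) +ᵥ y ≡ x
    ⊖-+ᵥ-cancel x y = trans (+ᵥ-assoc x (-ᵥ y) y) (trans (cong (x +ᵥ_) (+ᵥ-inverseˡ y)) (+ᵥ-identityʳ x))

    +ᵥ-⊖-cancel : ∀ (x y : V n) → (x +ᵥ y) ⊖ y ≡ x
    +ᵥ-⊖-cancel x y = trans (+ᵥ-assoc x y (-ᵥ y)) (trans (cong (x +ᵥ_) (+ᵥ-inverseʳ y)) (+ᵥ-identityʳ x))

    +ᵥ-swapʳ : ∀ (x y z : V n) → (x +ᵥ y) +ᵥ z ≡ (x +ᵥ z) +ᵥ y
    +ᵥ-swapʳ x y z = trans (+ᵥ-assoc x y z) (trans (cong (x +ᵥ_) (+ᵥ-comm y z)) (sym (+ᵥ-assoc x z y)))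

    +ᵥ-interchange : ∀ (x y z w : V n) → (x +ᵥ y) +ᵥ (z +ᵥ w) ≡ (x +ᵥ z) +ᵥ (y +ᵥ w)
    +ᵥ-interchange x y z w = begin
      (x +ᵥ y) +ᵥ (z +ᵥ w)  ≡⟨ +ᵥ-assoc (x +ᵥ y) z w ⟨
      (x +ᵥ y) +ᵥ z +ᵥ w    ≡⟨ cong (_+ᵥ w) (+ᵥ-swapʳ x y z) ⟩
      (x +ᵥ z) +ᵥ y +ᵥ w    ≡⟨ +ᵥ-assoc (x +ᵥ z) y w ⟩
      (x +ᵥ z) +ᵥ (y +ᵥ w)  ∎

    ⊖-translate : ∀ (x y z : V n) → (x +ᵥ z) ⊖ (y +ᵥ z) ≡ x ⊖ y
    ⊖-translate x y z = begin
      (x +ᵥ z) +ᵥ -ᵥ (y +ᵥ z)      ≡⟨ cong ((x +ᵥ z) +ᵥ_) (-ᵥ-+ᵥ y z) ⟨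
      (x +ᵥ z) +ᵥ (-ᵥ y +ᵥ -ᵥ z)   ≡⟨ +ᵥ-interchange x z (-ᵥ y) (-ᵥ z) ⟩
      (x ⊖ y) +ᵥ (z ⊖ z)         ≡⟨ cong ((x ⊖ y) +ᵥ_) (+ᵥ-inverseʳ z) ⟩
      (x ⊖ y) +ᵥ 0ᵥ               ≡⟨ +ᵥ-identityʳ (x ⊖ y) ⟩
      x ⊖ y                       ∎

  ·-distribˡ : ∀ {n} x (u v : V n) → x · (u +ᵥ v) ≡ x · u +ᵥ x · v
  ·-distribˡ x []      []      = refl
  ·-distribˡ x (a ∷ u) (b ∷ v) = cong₂ _∷_ (⊗-distribˡ-⊕ x a b) (·-distribˡ x u v)

  ·-distribʳ : ∀ {n} x y (v : V n) → (x ⊕ y) · v ≡ x · v +ᵥ y · v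
  ·-distribʳ x y []      = refl
  ·-distribʳ x y (a ∷ v) = cong₂ _∷_ (distribʳ a x y) (·-distribʳ x y v)

  ·-identity : ∀ {n} (v : V n) → zp p 1 · v ≡ v
  ·-identity []      = refl
  ·-identity (a ∷ v) = cong₂ _∷_ (⊗-identityˡ a) (·-identity v)

  ·-zero : ∀ {n} (v : V n) → zp p 0 · v ≡ 0ᵥ
  ·-zero []      = refl
  ·-zero (a ∷ v) = cong₂ _∷_ (zeroˡ a) (·-zero v)

  Additive : ∀ {n m} → (V n → V m) → Set
  Additive f = ∀ u v → f (u +ᵥ v) ≡ f u +ᵥ f v

  additive-0 : ∀ {n m} {f : V n → V m} → Additive f → f 0ᵥ ≡ 0ᵥ
  additive-0 {f = f} f-+ = +ᵥ-identityʳ-unique (f 0ᵥ) (f 0ᵥ) (trans (sym (f-+ 0ᵥ 0ᵥ)) (cong f (+ᵥ-identityˡ 0ᵥ)))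

  additive-neg : ∀ {n m} {f : V n → V m} → Additive f → ∀ v → f (-ᵥ v) ≡ -ᵥ f v
  additive-neg {f = f} f-+ v = -ᵥ-unique (f v) (f (-ᵥ v))
    (trans (sym (f-+ v (-ᵥ v))) (trans (cong f (+ᵥ-inverseʳ v)) (additive-0 {f = f} f-+)))

  additive-sub : ∀ {n m} {f : V n → V m} → Additive f → ∀ u v → f (u ⊖ v) ≡ f u ⊖ f v
  additive-sub {f = f} f-+ u v = trans (f-+ u (-ᵥ v)) (cong (f u +ᵥ_) (additive-neg {f = f} f-+ v))

  lin : ∀ {n m} → (Fin n → V m) → V n → V m
  lin b []      = 0ᵥ
  lin b (x ∷ v) = x · b fzero +ᵥ lin (b ∘ fsuc) v

  lin-additive : ∀ {n m} (b : Fin n → V m) → Additive (lin b)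
  lin-additive b []      []      = sym (+ᵥ-identityˡ 0ᵥ)
  lin-additive b (x ∷ u) (y ∷ v) = trans
    (cong₂ _+ᵥ_ (·-distribʳ x y (b fzero)) (lin-additive (b ∘ fsuc) u v))
    (+ᵥ-interchange (x · b fzero) (y · b fzero) (lin (b ∘ fsuc) u) (lin (b ∘ fsuc) v))

  lin-unit : ∀ {n m} (b : Fin n → V m) j → lin b (unit j) ≡ b j
  lin-unit b fzero    = trans (cong₂ _+ᵥ_ (·-identity (b fzero)) (additive-0 (lin-additive (b ∘ fsuc)))) (+ᵥ-identityʳ (b fzero))
  lin-unit b (fsuc j) = trans (cong₂ _+ᵥ_ (·-zero (b fzero)) (lin-unit (b ∘ fsuc) j)) (+ᵥ-identityˡ (b (fsuc j)))

  lin-cong : ∀ {n m} {b c : Fin n → V m} → (∀ j → b j ≡ c j) → ∀ v → lin b v ≡ lin c v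
  lin-cong b≗c []      = refl
  lin-cong b≗c (x ∷ v) = cong₂ _+ᵥ_ (cong (x ·_) (b≗c fzero)) (lin-cong (b≗c ∘ fsuc) v)

  -- Every residue is a repeated sum of 1, so sums of unit vectors reach every vector; the induction
  -- is over the coordinates.
  units-generate : ∀ {n} (P : V n → Set) → P 0ᵥ → (∀ j → P (unit j)) →
                   (∀ u v → P u → P v → P (u +ᵥ v)) → ∀ v → P v
  units-generate P P0 Punit P+ []      = P0
  units-generate P P0 Punit P+ (x ∷ v) = subst P split (P+ _ _ (first x) rest)
    where
    split : (x ∷ 0ᵥ) +ᵥ (zp p 0 ∷ v) ≡ x ∷ v
    split = cong₂ _∷_ (+-identityʳ x) (+ᵥ-identityˡ v)
    multiple : ∀ k → P (zp p k ∷ 0ᵥ)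
    multiple zero    = P0
    multiple (suc k) = subst P (cong₂ _∷_ (zp-+ 1 k) (+ᵥ-identityˡ 0ᵥ)) (P+ _ _ (Punit fzero) (multiple k))
    first : ∀ x → P (x ∷ 0ᵥ)
    first x = subst (λ y → P (y ∷ 0ᵥ)) (zp-toℕ x) (multiple (toℕ x))
    rest : P (zp p 0 ∷ v)
    rest = units-generate (λ u → P (zp p 0 ∷ u)) P0 (Punit ∘ fsuc)
      (λ u u' Pu Pu' → subst P (cong (_∷ (u +ᵥ u')) (+-identityʳ (zp p 0))) (P+ _ _ Pu Pu')) v

  -- Over ℤ_p additivity implies linearity: both sides are additive and agree on the unit vectors,
  -- which generate.
  additive⇒lin : ∀ {n m} {f : V n → V m} → Additive f → ∀ v → f v ≡ lin (f ∘ unit) v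
  additive⇒lin {f = f} f-+ = units-generate (λ v → f v ≡ lin (f ∘ unit) v)
    (trans (additive-0 {f = f} f-+) (sym (additive-0 (lin-additive (f ∘ unit)))))
    (λ j → sym (lin-unit (f ∘ unit) j))
    (λ u v fu fv → trans (f-+ u v) (trans (cong₂ _+ᵥ_ fu fv) (sym (lin-additive (f ∘ unit) u v))))

  module _ (pr : Prime p) where

    unit≢0 : ∀ {n} (j : Fin n) → unit j ≢ 0ᵥ
    unit≢0 fzero    eq = 1≢0 pr (Vecₚ.∷-injectiveˡ eq)
    unit≢0 (fsuc j) eq = unit≢0 j (Vecₚ.∷-injectiveʳ eq)

    unit-injective : ∀ {n} {i j : Fin n} → unit i ≡ unit j → i ≡ j
    unit-injective {i = fzero}  {fzero}  eq = refl
    unit-injective {i = fzero}  {fsuc j} eq = contradiction (Vecₚ.∷-injectiveˡ eq) (1≢0 pr)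
    unit-injective {i = fsuc i} {fzero}  eq = contradiction (sym (Vecₚ.∷-injectiveˡ eq)) (1≢0 pr)
    unit-injective {i = fsuc i} {fsuc j} eq = cong fsuc (unit-injective (Vecₚ.∷-injectiveʳ eq))

-- The generalised dihedral group and its right translations.

module Dihedral (n p : ℕ) .{{p≢0 : NonZero p}} where
  open Vectors p public

  G : Set
  G = GD n p

  infixl 7 _∙_
  infix 8 _⁻¹

  _∙_ : G → G → G
  _∙_ = gdMul n p

  1ᴳ : G
  1ᴳ = 0ᵥ , false

  _⁻¹ : G → G
  (x , false) ⁻¹ = -ᵥ x , false
  (x , true)  ⁻¹ = x , true

  assoc : ∀ x y z → (x ∙ y) ∙ z ≡ x ∙ (y ∙ z)
  assoc (x , false) (y , false) (z , g) = cong (_, g) (+ᵥ-assoc x y z)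
  assoc (x , false) (y , true)  (z , g) = cong (_, _) (+ᵥ-assoc x y (-ᵥ z))
  assoc (x , true)  (y , false) (z , g) = cong (_, _) (trans (+ᵥ-assoc x (-ᵥ y) (-ᵥ z)) (cong (x +ᵥ_) (-ᵥ-+ᵥ y z)))
  assoc (x , true)  (y , true)  (z , g) = cong₂ _,_ (trans (+ᵥ-assoc x (-ᵥ y) z) (cong (x +ᵥ_)
    (trans (cong (-ᵥ y +ᵥ_) (sym (-ᵥ-involutive z))) (-ᵥ-+ᵥ y (-ᵥ z))))) (sym (not-involutive g))

  identityˡ : ∀ x → 1ᴳ ∙ x ≡ x
  identityˡ (x , e) = cong (_, e) (+ᵥ-identityˡ x)

  identityʳ : ∀ x → x ∙ 1ᴳ ≡ x
  identityʳ (x , false) = cong (_, false) (+ᵥ-identityʳ x)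
  identityʳ (x , true)  = cong (_, true) (trans (cong (x +ᵥ_) -ᵥ-0) (+ᵥ-identityʳ x))

  inverseˡ : ∀ x → x ⁻¹ ∙ x ≡ 1ᴳ
  inverseˡ (x , false) = cong (_, false) (+ᵥ-inverseˡ x)
  inverseˡ (x , true)  = cong (_, false) (+ᵥ-inverseʳ x)

  inverseʳ : ∀ x → x ∙ x ⁻¹ ≡ 1ᴳ
  inverseʳ (x , false) = cong (_, false) (+ᵥ-inverseʳ x)
  inverseʳ (x , true)  = cong (_, false) (+ᵥ-inverseʳ x)

  GD-group : Group 0ℓ 0ℓ
  GD-group = record
    { isGroup = record
      { isMonoid = record
        { isSemigroup = record
          { isMagma = record { isEquivalence = isEquivalence ; ∙-cong = cong₂ _∙_ }
          ; assoc = assoc }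
        ; identity = identityˡ , identityʳ }
      ; inverse = inverseˡ , inverseʳ
      ; ⁻¹-cong = cong _⁻¹ } }

  open GroupProperties GD-group public using (∙-cancelʳ)

  ∙-⁻¹-cancel : ∀ x y → (x ∙ y) ∙ y ⁻¹ ≡ x
  ∙-⁻¹-cancel x y = trans (assoc x y (y ⁻¹)) (trans (cong (x ∙_) (inverseʳ y)) (identityʳ x))

  ⁻¹-∙-cancel : ∀ x y → (x ∙ y ⁻¹) ∙ y ≡ x
  ⁻¹-∙-cancel x y = trans (assoc x (y ⁻¹) y) (trans (cong (x ∙_) (inverseˡ y)) (identityʳ x))

  parity : G → Bool
  parity = proj₂

  -- The elements of parity `false` form the normal subgroup V. Two versions are given, with the
  -- inverse on either side, to match the two directions of conjugation.
  conj-parity : ∀ g v → parity ((g ∙ (v , false)) ∙ g ⁻¹) ≡ false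
  conj-parity (x , false) v = refl
  conj-parity (x , true)  v = refl

  conj-parity′ : ∀ g v → parity ((g ⁻¹ ∙ (v , false)) ∙ g) ≡ false
  conj-parity′ (x , false) v = refl
  conj-parity′ (x , true)  v = refl

  ρ : G → Perm G
  ρ g = mk↔ₛ′ (_∙ g) (_∙ g ⁻¹) (λ x → ⁻¹-∙-cancel x g) (λ x → ∙-⁻¹-cancel x g)

-- Five points, their affine symmetries, and the resulting graph automorphisms.

module Configuration (n p : ℕ) .{{p≢0 : NonZero p}} (w : Fin 5 → Vec (Fin p) n) (bs : Fin n → Fin 5)
  (w-origin : w fzero ≡ Vectors.0ᵥ p) (w-basis : ∀ j → w (bs j) ≡ Vectors.unit p j) where
  open Dihedral n p public

  s : Fin 5 → G
  s i = w i , true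

  S : List G
  S = s 0F ∷ s 1F ∷ s 2F ∷ s 3F ∷ s 4F ∷ []

  s∈S : ∀ i → s i ∈ S
  s∈S 0F = here refl
  s∈S 1F = there (here refl)
  s∈S 2F = there (there (here refl))
  s∈S 3F = there (there (there (here refl)))
  s∈S 4F = there (there (there (there (here refl))))

  ∈S⇒s : ∀ {x} → x ∈ S → ∃ λ i → x ≡ s i
  ∈S⇒s (here eq)                                 = 0F , eq
  ∈S⇒s (there (here eq))                         = 1F , eq
  ∈S⇒s (there (there (here eq)))                 = 2F , eq
  ∈S⇒s (there (there (there (here eq))))         = 3F , eq
  ∈S⇒s (there (there (there (there (here eq))))) = 4F , eq

  -- As `w 0F` is the origin, the unit vector `j` is `w (bs j)` minus `w 0F`; an affine map inducing
  -- `π` has to send it to this difference.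
  frame : (Fin 5 → Fin 5) → Fin n → V n
  frame π j = w (π (bs j)) ⊖ w (π 0F)

  L : (Fin 5 → Fin 5) → V n → V n
  L π = lin (frame π)

  -- v ↦ L π v + w (π 0) is the affine map that agrees with w i ↦ w (π i) on the affine basis formed by w 0
  -- and the w (bs j); π is admissible if the two agree on all five points.
  Admissible : (Fin 5 → Fin 5) → Set
  Admissible π = ∀ i → L π (w i) +ᵥ w (π 0F) ≡ w (π i)

  admissible? : ∀ π → Dec (Admissible π)
  admissible? π = all? λ i → Vecₚ.≡-dec _≟ᶠ_ (L π (w i) +ᵥ w (π 0F)) (w (π i))

  -- The endomorphism of `G` that is `L π` on V and sends h to `w (π 0F)` h; for admissible `π` it
  -- maps `s i` to `s (π i)`.
  Φ : (Fin 5 → Fin 5) → G → G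
  Φ π (v , false) = L π v , false
  Φ π (v , true)  = L π v +ᵥ w (π 0F) , true

  L-additive : ∀ π → Additive (L π)
  L-additive π = lin-additive (frame π)

  -- The offset `w (π 0F)` occurs once when one factor lies outside V and cancels when both do.
  Φ-∙ : ∀ π x y → Φ π (x ∙ y) ≡ Φ π x ∙ Φ π y
  Φ-∙ π (x , false) (y , false) = cong (_, false) (L-additive π x y)
  Φ-∙ π (x , false) (y , true)  = cong (_, true)
    (trans (cong (_+ᵥ c) (L-additive π x y)) (+ᵥ-assoc (L π x) (L π y) c))
    where c = w (π 0F)
  Φ-∙ π (x , true)  (y , false) = cong (_, true)
    (trans (cong (_+ᵥ c) (additive-sub (L-additive π) x y)) (+ᵥ-swapʳ (L π x) (-ᵥ L π y) c))
    where c = w (π 0F)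
  Φ-∙ π (x , true)  (y , true)  = cong (_, false)
    (trans (additive-sub (L-additive π) x y) (sym (⊖-translate (L π x) (L π y) (w (π 0F)))))

  Φ-cong : ∀ {π σ} → (∀ i → π i ≡ σ i) → ∀ x → Φ π x ≡ Φ σ x
  Φ-cong {π} {σ} π≗σ = λ where
      (v , false) → cong (_, false) (lin-cong frames v)
      (v , true)  → cong (_, true) (cong₂ _+ᵥ_ (lin-cong frames v) (cong w (π≗σ 0F)))
    where
    frames : ∀ j → frame π j ≡ frame σ j
    frames j = cong₂ (λ a b → w a ⊖ w b) (π≗σ (bs j)) (π≗σ 0F)

  Admissible-resp : ∀ {π σ} → (∀ i → π i ≡ σ i) → Admissible π → Admissible σ
  Admissible-resp {π} {σ} π≗σ adm i = begin
    L σ (w i) +ᵥ w (σ 0F)   ≡⟨ cong proj₁ (Φ-cong π≗σ (s i)) ⟨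
    L π (w i) +ᵥ w (π 0F)   ≡⟨ adm i ⟩
    w (π i)                 ≡⟨ cong w (π≗σ i) ⟩
    w (σ i)                 ∎
    where open ≡-Reasoning

  Φ-id : ∀ x → Φ id x ≡ x
  Φ-id = λ where
      (v , false) → cong (_, false) (L-id v)
      (v , true)  → cong (_, true) (trans (cong₂ _+ᵥ_ (L-id v) w-origin) (+ᵥ-identityʳ v))
    where
    frame-id : ∀ j → frame id j ≡ unit j
    frame-id j = trans (cong₂ _⊖_ (w-basis j) w-origin) (trans (cong (unit j +ᵥ_) -ᵥ-0) (+ᵥ-identityʳ (unit j)))
    L-id : ∀ v → L id v ≡ v
    L-id v = trans (lin-cong frame-id v) (sym (additive⇒lin {f = id} (λ _ _ → refl) v))

  Φ-s : ∀ {π} → Admissible π → ∀ i → Φ π (s i) ≡ s (π i)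
  Φ-s adm i = cong (_, true) (adm i)

  Φ-1 : ∀ π → Φ π 1ᴳ ≡ 1ᴳ
  Φ-1 π = cong (_, false) (additive-0 (L-additive π))

  module _ {σ : Fin 5 → Fin 5} (adm : Admissible σ) (π : Fin 5 → Fin 5) where

    -- Both sides are additive, so unit vectors suffice. There `L π` yields differences of points,
    -- which the admissible `σ` maps to differences of image points, the offset `w (σ 0F)`
    -- cancelling.
    L-∘ : ∀ v → L σ (L π v) ≡ L (σ ∘ π) v
    L-∘ v = trans (additive⇒lin {f = L σ ∘ L π} (λ x y → trans (cong (L σ) (L-additive π x y)) (L-additive σ (L π x) (L π y))) v)
                  (lin-cong frames v)
      where
      open ≡-Reasoning
      frames : ∀ j → L σ (L π (unit j)) ≡ frame (σ ∘ π) j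
      frames j = begin
        L σ (L π (unit j))                        ≡⟨ cong (L σ) (lin-unit (frame π) j) ⟩
        L σ (w (π (bs j)) ⊖ w (π 0F))             ≡⟨ additive-sub (L-additive σ) (w (π (bs j))) (w (π 0F)) ⟩
        L σ (w (π (bs j))) ⊖ L σ (w (π 0F))       ≡⟨ ⊖-translate _ _ (w (σ 0F)) ⟨
        (L σ (w (π (bs j))) +ᵥ w (σ 0F)) ⊖ (L σ (w (π 0F)) +ᵥ w (σ 0F)) ≡⟨ cong₂ _⊖_ (adm (π (bs j))) (adm (π 0F)) ⟩
        frame (σ ∘ π) j                           ∎

    Φ-∘ : ∀ x → Φ σ (Φ π x) ≡ Φ (σ ∘ π) x
    Φ-∘ (v , false) = cong (_, false) (L-∘ v)
    Φ-∘ (v , true)  = cong (_, true) (trans (cong (_+ᵥ w (σ 0F)) (L-additive σ (L π v) (w (π 0F))))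
      (trans (+ᵥ-assoc (L σ (L π v)) (L σ (w (π 0F))) (w (σ 0F))) (cong₂ _+ᵥ_ (L-∘ v) (adm (π 0F)))))

  -- Admissibility is recorded in both directions because `Φ-∘` asks it of the outer map, and each
  -- map is the outer one in one of the two composites.
  record Symmetry : Set where
    field
      to from       : Fin 5 → Fin 5
      to-from       : ∀ i → to (from i) ≡ i
      from-to       : ∀ i → from (to i) ≡ i
      to-admissible   : Admissible to
      from-admissible : Admissible from

    Φ-to-from : ∀ x → Φ to (Φ from x) ≡ x
    Φ-to-from x = trans (Φ-∘ to-admissible from x) (trans (Φ-cong to-from x) (Φ-id x))

    Φ-from-to : ∀ x → Φ from (Φ to x) ≡ x
    Φ-from-to x = trans (Φ-∘ from-admissible to x) (trans (Φ-cong from-to x) (Φ-id x))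

    perm : Perm G
    perm = mk↔ₛ′ (Φ to) (Φ from) Φ-to-from Φ-from-to

  A : PermSet G
  A = Aut n p S

  R : PermSet G
  R = RegRep n p

  -- The translations by V, which form the Sylow p-subgroup of R(G) when p is odd.
  Rᵥ : PermSet G
  Rᵥ σ = ∃ λ v → ∀ x → app σ x ≡ x ∙ (v , false)

  -- Membership in the holomorph of `G`: an automorphism of the group followed by a right
  -- translation.
  Holomorphic : Symmetry → G → Perm G → Set
  Holomorphic μ g σ = ∀ x → app σ x ≡ Φ (Symmetry.to μ) x ∙ g

  module _ (μ : Symmetry) (g : G) {σ : Perm G} (σ≗ : Holomorphic μ g σ) where
    open Symmetry μ
    open ≡-Reasoning

    -- The intertwining relation from which the conjugates of right translations by `σ` are read
    -- off.
    holomorphic-∙ : ∀ x k → app σ (x ∙ k) ≡ app σ x ∙ ((g ⁻¹ ∙ Φ to k) ∙ g)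
    holomorphic-∙ x k = begin
      app σ (x ∙ k)                                ≡⟨ σ≗ (x ∙ k) ⟩
      Φ to (x ∙ k) ∙ g                             ≡⟨ cong (_∙ g) (Φ-∙ to x k) ⟩
      (Φ to x ∙ Φ to k) ∙ g                        ≡⟨ cong (λ y → (y ∙ Φ to k) ∙ g) (∙-⁻¹-cancel (Φ to x) g) ⟨
      (((Φ to x ∙ g) ∙ g ⁻¹) ∙ Φ to k) ∙ g         ≡⟨ cong (_∙ g) (assoc (Φ to x ∙ g) (g ⁻¹) (Φ to k)) ⟩
      ((Φ to x ∙ g) ∙ (g ⁻¹ ∙ Φ to k)) ∙ g         ≡⟨ assoc (Φ to x ∙ g) (g ⁻¹ ∙ Φ to k) g ⟩
      (Φ to x ∙ g) ∙ ((g ⁻¹ ∙ Φ to k) ∙ g)         ≡⟨ cong (_∙ ((g ⁻¹ ∙ Φ to k) ∙ g)) (σ≗ x) ⟨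
      app σ x ∙ ((g ⁻¹ ∙ Φ to k) ∙ g)              ∎

    holomorphic-∙′ : ∀ x k → app σ x ∙ k ≡ app σ (x ∙ Φ from ((g ∙ k) ∙ g ⁻¹))
    holomorphic-∙′ x k = sym (trans (holomorphic-∙ x (Φ from ((g ∙ k) ∙ g ⁻¹))) (cong (app σ x ∙_) (begin
      (g ⁻¹ ∙ Φ to (Φ from ((g ∙ k) ∙ g ⁻¹))) ∙ g  ≡⟨ cong (λ y → (g ⁻¹ ∙ y) ∙ g) (Φ-to-from ((g ∙ k) ∙ g ⁻¹)) ⟩
      (g ⁻¹ ∙ ((g ∙ k) ∙ g ⁻¹)) ∙ g                ≡⟨ assoc (g ⁻¹) ((g ∙ k) ∙ g ⁻¹) g ⟩
      g ⁻¹ ∙ (((g ∙ k) ∙ g ⁻¹) ∙ g)                ≡⟨ cong (g ⁻¹ ∙_) (⁻¹-∙-cancel (g ∙ k) g) ⟩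
      g ⁻¹ ∙ (g ∙ k)                               ≡⟨ assoc (g ⁻¹) g k ⟨
      (g ⁻¹ ∙ g) ∙ k                               ≡⟨ cong (_∙ k) (inverseˡ g) ⟩
      1ᴳ ∙ k                                       ≡⟨ identityˡ k ⟩
      k                                            ∎)))

    -- `Φ to` permutes the connection set, and left multiplication by its elements commutes with the
    -- right translation by `g`.
    holomorphic⇒automorphism : A σ
    holomorphic⇒automorphism x y = forward , backward
      where
      forward : Adj n p S x y → Adj n p S (app σ x) (app σ y)
      forward (t , t∈S , y≡tx) =
        let i , t≡si = ∈S⇒s t∈S in
        s (to i) , s∈S (to i) , (begin
          app σ y                    ≡⟨ σ≗ y ⟩
          Φ to y ∙ g                 ≡⟨ cong (λ z → Φ to z ∙ g) (trans y≡tx (cong (_∙ x) t≡si)) ⟩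
          Φ to (s i ∙ x) ∙ g         ≡⟨ cong (_∙ g) (trans (Φ-∙ to (s i) x) (cong (_∙ Φ to x) (Φ-s to-admissible i))) ⟩
          (s (to i) ∙ Φ to x) ∙ g    ≡⟨ assoc (s (to i)) (Φ to x) g ⟩
          s (to i) ∙ (Φ to x ∙ g)    ≡⟨ cong (s (to i) ∙_) (σ≗ x) ⟨
          s (to i) ∙ app σ x         ∎)
      backward : Adj n p S (app σ x) (app σ y) → Adj n p S x y
      backward (t , t∈S , σy≡tσx) =
        let i , t≡si = ∈S⇒s t∈S in
        s (from i) , s∈S (from i) , (begin
          y                            ≡⟨ Φ-from-to y ⟨
          Φ from (Φ to y)              ≡⟨ cong (Φ from) (∙-cancelʳ g _ _ (begin
            Φ to y ∙ g                   ≡⟨ σ≗ y ⟨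
            app σ y                      ≡⟨ trans σy≡tσx (cong (_∙ app σ x) t≡si) ⟩
            s i ∙ app σ x                ≡⟨ cong (s i ∙_) (σ≗ x) ⟩
            s i ∙ (Φ to x ∙ g)           ≡⟨ assoc (s i) (Φ to x) g ⟨
            (s i ∙ Φ to x) ∙ g           ∎)) ⟩
          Φ from (s i ∙ Φ to x)        ≡⟨ Φ-∙ from (s i) (Φ to x) ⟩
          Φ from (s i) ∙ Φ from (Φ to x) ≡⟨ cong₂ _∙_ (Φ-s from-admissible i) (Φ-from-to x) ⟩
          s (from i) ∙ x               ∎)

    private
      σ⁻¹ = Inverse.from σ
      σσ⁻¹ = Inverse.strictlyInverseˡ σ
      σ⁻¹σ = Inverse.strictlyInverseʳ σ

    conjugate : ∀ {τ : Perm G} {k} → (∀ x → app τ x ≡ x ∙ k) →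
                ∀ x → app ((σ ∘ₚ τ) ∘ₚ (σ ⁻¹ₚ)) x ≡ x ∙ ((g ⁻¹ ∙ Φ to k) ∙ g)
    conjugate {τ} {k} τ≗ x = begin
      app σ (app τ (σ⁻¹ x))                      ≡⟨ cong (app σ) (τ≗ (σ⁻¹ x)) ⟩
      app σ (σ⁻¹ x ∙ k)                          ≡⟨ holomorphic-∙ (σ⁻¹ x) k ⟩
      app σ (σ⁻¹ x) ∙ ((g ⁻¹ ∙ Φ to k) ∙ g)      ≡⟨ cong (_∙ ((g ⁻¹ ∙ Φ to k) ∙ g)) (σσ⁻¹ x) ⟩
      x ∙ ((g ⁻¹ ∙ Φ to k) ∙ g)                  ∎

    conjugate⁻¹ : ∀ {τ : Perm G} {k} → (∀ x → app ((σ ∘ₚ τ) ∘ₚ (σ ⁻¹ₚ)) x ≡ x ∙ k) →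
                  ∀ x → app τ x ≡ x ∙ Φ from ((g ∙ k) ∙ g ⁻¹)
    conjugate⁻¹ {τ} {k} conj≗ x = begin
      app τ x                                    ≡⟨ σ⁻¹σ (app τ x) ⟨
      σ⁻¹ (app σ (app τ x))                      ≡⟨ cong (λ y → σ⁻¹ (app σ (app τ y))) (σ⁻¹σ x) ⟨
      σ⁻¹ (app σ (app τ (σ⁻¹ (app σ x))))        ≡⟨ cong σ⁻¹ (conj≗ (app σ x)) ⟩
      σ⁻¹ (app σ x ∙ k)                          ≡⟨ cong σ⁻¹ (holomorphic-∙′ x k) ⟩
      σ⁻¹ (app σ (x ∙ Φ from ((g ∙ k) ∙ g ⁻¹)))  ≡⟨ σ⁻¹σ _ ⟩
      x ∙ Φ from ((g ∙ k) ∙ g ⁻¹)                ∎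

    holomorphic⇒normalizes-R : Normalizer A R σ
    holomorphic⇒normalizes-R = holomorphic⇒automorphism , λ τ →
      (λ (k , τ≗) → _ , conjugate {τ} τ≗) , (λ (k , conj≗) → _ , conjugate⁻¹ {τ} conj≗)

    private
      flat : ∀ {τ : Perm G} (k : G) → parity k ≡ false → (∀ x → app τ x ≡ x ∙ k) → Rᵥ τ
      flat (v , false) refl τ≗ = v , τ≗

      Φ-flat : ∀ π k → parity k ≡ false → parity (Φ π k) ≡ false
      Φ-flat π (v , false) refl = refl

    holomorphic⇒normalizes-Rᵥ : Normalizer A Rᵥ σ
    holomorphic⇒normalizes-Rᵥ = holomorphic⇒automorphism , λ τ →
      (λ (v , τ≗) → flat {(σ ∘ₚ τ) ∘ₚ (σ ⁻¹ₚ)} _ (conj-parity′ g (L to v)) (conjugate {τ} τ≗)) ,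
      (λ (v , conj≗) → flat {τ} _ (Φ-flat from _ (conj-parity g v)) (conjugate⁻¹ {τ} conj≗))

  -- With v = s i u and v' = s j u', the map x ↦ Φ π x ∙ (Φ π u)⁻¹ ∙ u' carries the arc (u , v) to (u' , v') if π i = j.
  arc-transitive : ∀ {H : PermSet G} →
    (∀ μ g σ → Holomorphic μ g σ → H σ) →
    (∀ i j → ∃ λ μ → Symmetry.to μ i ≡ j) →
    ArcTransitive n p S H
  arc-transitive {H} hol⊆H move u v u' v' (t , t∈S , v≡tu) (t' , t'∈S , v'≡t'u') =
    let i , t≡si = ∈S⇒s t∈S
        j , t'≡sj = ∈S⇒s t'∈S
        μ , μi≡j = move i j
        open Symmetry μ
        g = Φ to u ⁻¹ ∙ u'
        σu≡u' : Φ to u ∙ g ≡ u'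
        σu≡u' = trans (sym (assoc (Φ to u) (Φ to u ⁻¹) u')) (trans (cong (_∙ u') (inverseʳ (Φ to u))) (identityˡ u'))
    in ρ g ∘ₚ perm , hol⊆H μ g (ρ g ∘ₚ perm) (λ _ → refl) , σu≡u' , (begin
      Φ to v ∙ g                 ≡⟨ cong (λ y → Φ to y ∙ g) (trans v≡tu (cong (_∙ u) t≡si)) ⟩
      Φ to (s i ∙ u) ∙ g         ≡⟨ cong (_∙ g) (trans (Φ-∙ to (s i) u) (cong (_∙ Φ to u) (trans (Φ-s to-admissible i) (cong s μi≡j)))) ⟩
      (s j ∙ Φ to u) ∙ g         ≡⟨ assoc (s j) (Φ to u) g ⟩
      s j ∙ (Φ to u ∙ g)         ≡⟨ cong₂ _∙_ (sym t'≡sj) σu≡u' ⟩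
      t' ∙ u'                    ≡⟨ v'≡t'u' ⟨
      v'                         ∎)
    where open ≡-Reasoning

-- Elements of the normalisers are affine.

module Normalizers (n p : ℕ) .{{p≢0 : NonZero p}} (w : Fin 5 → Vec (Fin p) n) (bs : Fin n → Fin 5)
  (w-origin : w fzero ≡ Vectors.0ᵥ p) (w-basis : ∀ j → w (bs j) ≡ Vectors.unit p j)
  (w-injective : Injective _≡_ _≡_ w) where
  open Configuration n p w bs w-origin w-basis public

  module _ (σ : Perm G) (aut : A σ) where

    open ≡-Reasoning

    step : ∀ i x → ∃ λ j → app σ (s i ∙ x) ≡ s j ∙ app σ x
    step i x =
      let t , t∈S , eq = proj₁ (aut x (s i ∙ x)) (s i , s∈S i , refl)
          j , t≡sj = ∈S⇒s t∈S
      in j , trans eq (cong (_∙ app σ x) t≡sj)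

    -- The common consequence of normalising `Rᵥ` or `R`: conjugation by `σ` turns the translation
    -- by `v` into a translation by V.
    Flat : V n → Set
    Flat v = ∃ λ u → ∀ x → app σ (x ∙ (v , false)) ≡ app σ x ∙ (u , false)

    module _ (flat : ∀ v → Flat v) where

      private
        -- Dividing by the image of 1 leaves a map `f` that fixes 1.
        g = app σ 1ᴳ

        f : G → G
        f x = app σ x ∙ g ⁻¹

        -- The neighbours of 1 are the `s i`, and `σ` takes them to neighbours of `g`; this gives
        -- the map on indices.
        π : Fin 5 → Fin 5
        π i = proj₁ (step i 1ᴳ)

        f-s : ∀ i → f (s i) ≡ s (π i)
        f-s i = begin
          app σ (s i) ∙ g ⁻¹         ≡⟨ cong (λ x → app σ x ∙ g ⁻¹) (identityʳ (s i)) ⟨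
          app σ (s i ∙ 1ᴳ) ∙ g ⁻¹    ≡⟨ cong (_∙ g ⁻¹) (proj₂ (step i 1ᴳ)) ⟩
          (s (π i) ∙ g) ∙ g ⁻¹       ≡⟨ ∙-⁻¹-cancel (s (π i)) g ⟩
          s (π i)                    ∎

        F : V n → V n
        F v = proj₁ ((g ∙ (proj₁ (flat v) , false)) ∙ g ⁻¹)

        f-∙ : ∀ x v → f (x ∙ (v , false)) ≡ f x ∙ (F v , false)
        f-∙ x v = begin
          app σ (x ∙ (v , false)) ∙ g ⁻¹          ≡⟨ cong (_∙ g ⁻¹) (proj₂ (flat v) x) ⟩
          (app σ x ∙ k) ∙ g ⁻¹                    ≡⟨ cong (λ y → (y ∙ k) ∙ g ⁻¹) (⁻¹-∙-cancel (app σ x) g) ⟨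
          ((f x ∙ g) ∙ k) ∙ g ⁻¹                  ≡⟨ cong (_∙ g ⁻¹) (assoc (f x) g k) ⟩
          (f x ∙ (g ∙ k)) ∙ g ⁻¹                  ≡⟨ assoc (f x) (g ∙ k) (g ⁻¹) ⟩
          f x ∙ ((g ∙ k) ∙ g ⁻¹)                  ≡⟨ cong (λ e → f x ∙ (F v , e)) (conj-parity g (proj₁ (flat v))) ⟩
          f x ∙ (F v , false)                     ∎
          where k = proj₁ (flat v) , false

        f-flat : ∀ v → f (v , false) ≡ (F v , false)
        f-flat v = begin
          f (v , false)                ≡⟨ cong f (identityˡ (v , false)) ⟨
          f (1ᴳ ∙ (v , false))         ≡⟨ f-∙ 1ᴳ v ⟩
          (g ∙ g ⁻¹) ∙ (F v , false)   ≡⟨ cong (_∙ (F v , false)) (inverseʳ g) ⟩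
          1ᴳ ∙ (F v , false)           ≡⟨ identityˡ (F v , false) ⟩
          F v , false                  ∎

        F-additive : Additive F
        F-additive u v = cong proj₁ (begin
          F (u +ᵥ v) , false               ≡⟨ f-flat (u +ᵥ v) ⟨
          f ((u , false) ∙ (v , false))    ≡⟨ f-∙ (u , false) v ⟩
          f (u , false) ∙ (F v , false)    ≡⟨ cong (_∙ (F v , false)) (f-flat u) ⟩
          (F u , false) ∙ (F v , false)    ∎)

        -- Right multiplication by `v` takes `v` h to h, that is to `s 0F`, whose image is known;
        -- cancelling `F v` gives the image of `v` h.
        f-sharp : ∀ v → f (v , true) ≡ (F v +ᵥ w (π 0F) , true)
        f-sharp v = ∙-cancelʳ (F v , false) _ _ (begin
          f (v , true) ∙ (F v , false)           ≡⟨ f-∙ (v , true) v ⟨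
          f (v ⊖ v , true)                       ≡⟨ cong (λ u → f (u , true)) (trans (+ᵥ-inverseʳ v) (sym w-origin)) ⟩
          f (s 0F)                               ≡⟨ f-s 0F ⟩
          w (π 0F) , true                        ≡⟨ cong (_, true) (trans (cong (_⊖ F v) (+ᵥ-comm (F v) (w (π 0F)))) (+ᵥ-⊖-cancel (w (π 0F)) (F v))) ⟨
          (F v +ᵥ w (π 0F)) ⊖ F v , true         ∎)

        F-w : ∀ i → F (w i) +ᵥ w (π 0F) ≡ w (π i)
        F-w i = cong proj₁ (trans (sym (f-sharp (w i))) (f-s i))

        F≗L : ∀ v → F v ≡ L π v
        F≗L v = trans (additive⇒lin {f = F} F-additive v) (lin-cong F-unit v)
          where
          F-unit : ∀ j → F (unit j) ≡ frame π j
          F-unit j = begin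
            F (unit j)                                  ≡⟨ +ᵥ-⊖-cancel (F (unit j)) (w (π 0F)) ⟨
            (F (unit j) +ᵥ w (π 0F)) ⊖ w (π 0F)         ≡⟨ cong (λ u → (F u +ᵥ w (π 0F)) ⊖ w (π 0F)) (w-basis j) ⟨
            (F (w (bs j)) +ᵥ w (π 0F)) ⊖ w (π 0F)       ≡⟨ cong (_⊖ w (π 0F)) (F-w (bs j)) ⟩
            frame π j                                   ∎

        f≗Φ : ∀ x → f x ≡ Φ π x
        f≗Φ (v , false) = trans (f-flat v) (cong (_, false) (F≗L v))
        f≗Φ (v , true)  = trans (f-sharp v) (cong (λ u → u +ᵥ w (π 0F) , true) (F≗L v))

        π-injective : Injective _≡_ _≡_ π
        π-injective {i} {j} πi≡πj = w-injective (cong proj₁ (↔-injective σ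
          (∙-cancelʳ (g ⁻¹) _ _ (trans (f-s i) (trans (cong s πi≡πj) (sym (f-s j)))))))

      -- The additive map `F` is forced to be `L π` by its values at the basis points, and `f-sharp`
      -- then fixes `f` off V; multiplying by `g` recovers `σ`.
      flat⇒affine : ∃ λ π → Injective _≡_ _≡_ π × Admissible π × ∃ λ g → ∀ x → app σ x ≡ Φ π x ∙ g
      flat⇒affine = π , π-injective , (λ i → trans (cong (_+ᵥ w (π 0F)) (sym (F≗L (w i)))) (F-w i)) , g ,
        λ x → trans (sym (⁻¹-∙-cancel (app σ x) g)) (cong (_∙ g) (f≗Φ x))

    -- The vectors whose translations are carried to translations are closed under addition, so unit
    -- vectors suffice.
    flat-generated : (∀ j → Flat (unit j)) → ∀ v → Flat v
    flat-generated flat-unit = units-generate Flat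
      (0ᵥ , λ x → trans (cong (app σ) (identityʳ x)) (sym (identityʳ (app σ x)))) flat-unit add
      where
      add : ∀ u v → Flat u → Flat v → Flat (u +ᵥ v)
      add u v (u' , σu) (v' , σv) = u' +ᵥ v' , λ x → begin
        app σ (x ∙ ((u , false) ∙ (v , false)))          ≡⟨ cong (app σ) (assoc x (u , false) (v , false)) ⟨
        app σ ((x ∙ (u , false)) ∙ (v , false))          ≡⟨ σv (x ∙ (u , false)) ⟩
        app σ (x ∙ (u , false)) ∙ (v' , false)           ≡⟨ cong (_∙ (v' , false)) (σu x) ⟩
        (app σ x ∙ (u' , false)) ∙ (v' , false)          ≡⟨ assoc (app σ x) (u' , false) (v' , false) ⟩
        app σ x ∙ (u' +ᵥ v' , false)                     ∎

    -- (0 , false) and (w (bs j) , false) have the common neighbour (0 , true), and adjacency flips the parity.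
    neighbours-parity : ∀ j → parity (app σ (unit j , false)) ≡ parity (app σ 1ᴳ)
    neighbours-parity j = not-injective (begin
      not (parity (app σ (unit j , false)))    ≡⟨ cong parity (proj₂ (step (bs j) (unit j , false))) ⟨
      parity (app σ (s (bs j) ∙ (unit j , false))) ≡⟨ cong (λ u → parity (app σ (u ⊖ unit j , true))) (w-basis j) ⟩
      parity (app σ (unit j ⊖ unit j , true))  ≡⟨ cong (λ u → parity (app σ (u , true))) (trans (+ᵥ-inverseʳ (unit j)) (sym w-origin)) ⟩
      parity (app σ (s 0F))                    ≡⟨ cong (parity ∘ app σ) (identityʳ (s 0F)) ⟨
      parity (app σ (s 0F ∙ 1ᴳ))               ≡⟨ cong parity (proj₂ (step 0F 1ᴳ)) ⟩
      not (parity (app σ 1ᴳ))                  ∎)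

  private
    normalizes⇒translation : ∀ σ k y →
      (∀ x → app σ (Inverse.from σ x ∙ k) ≡ x ∙ y) → ∀ x → app σ (x ∙ k) ≡ app σ x ∙ y
    normalizes⇒translation σ k y conj≗ x =
      trans (cong (λ z → app σ (z ∙ k)) (sym (Inverse.strictlyInverseʳ σ x))) (conj≗ (app σ x))

    xor-cancel : ∀ a b → a xor b ≡ a → b ≡ false
    xor-cancel false b     eq = eq
    xor-cancel true  false eq = refl

  normalizes-Rᵥ⇒affine : ∀ σ → Normalizer A Rᵥ σ →
    ∃ λ π → Injective _≡_ _≡_ π × Admissible π × ∃ λ g → ∀ x → app σ x ≡ Φ π x ∙ g
  normalizes-Rᵥ⇒affine σ (aut , norm) = flat⇒affine σ aut λ v →
    let u , conj≗ = proj₁ (norm (ρ (v , false))) (v , λ _ → refl)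
    in u , normalizes⇒translation σ (v , false) (u , false) conj≗

  -- The conjugate of a translation by a unit vector is right multiplication by some `k`. That `k`
  -- lies in V is a property of the graph, by `neighbours-parity`; group theory alone would not give
  -- it for p = 2, where `G` is elementary abelian.
  normalizes-R⇒affine : ∀ σ → Normalizer A R σ →
    ∃ λ π → Injective _≡_ _≡_ π × Admissible π × ∃ λ g → ∀ x → app σ x ≡ Φ π x ∙ g
  normalizes-R⇒affine σ (aut , norm) = flat⇒affine σ aut (flat-generated σ aut λ j →
    let k , conj≗ = proj₁ (norm (ρ (unit j , false))) ((unit j , false) , λ _ → refl)
        σk = normalizes⇒translation σ (unit j , false) k conj≗
        k-parity : parity k ≡ false
        k-parity = xor-cancel (parity (app σ 1ᴳ)) (parity k)
          (trans (sym (cong parity (trans (cong (app σ) (sym (identityˡ (unit j , false)))) (σk 1ᴳ)))) (neighbours-parity σ aut j))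
    in proj₁ k , λ x → trans (σk x) (cong (λ e → app σ x ∙ (proj₁ k , e)) k-parity))

-- Sizes of sets of permutations.

module _ {X : Set} where

  module _ {H K : PermSet X} (H⊆K : ∀ σ → H σ → K σ) {a b : ℕ} where

    embed : HasSize H a → HasSize K b → Fin a → Fin b
    embed (h , h∈H , _ , _) (_ , _ , _ , k-onto) i = proj₁ (k-onto (lookup h i) (H⊆K _ (h∈H i)))

    embed-≈ : (|H| : HasSize H a) (|K| : HasSize K b) → ∀ i → lookup (proj₁ |H|) i ≈ₚ lookup (proj₁ |K|) (embed |H| |K| i)
    embed-≈ (h , h∈H , _ , _) (_ , _ , _ , k-onto) i = proj₂ (k-onto (lookup h i) (H⊆K _ (h∈H i)))

    embed-injective : (|H| : HasSize H a) (|K| : HasSize K b) → Injective _≡_ _≡_ (embed |H| |K|)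
    embed-injective |H| |K| {i} {j} eq = proj₁ (proj₂ (proj₂ |H|)) i j λ x →
      trans (embed-≈ |H| |K| i x) (trans (cong (λ l → app (lookup (proj₁ |K|) l) x) eq) (sym (embed-≈ |H| |K| j x)))

    size-mono : HasSize H a → HasSize K b → a ≤ b
    size-mono |H| |K| = injective⇒≤ (embed-injective |H| |K|)

  size-unique : ∀ {H : PermSet X} {a b} → HasSize H a → HasSize H b → a ≡ b
  size-unique |H| |H|′ = ℕₚ.≤-antisym (size-mono (λ _ h → h) |H| |H|′) (size-mono (λ _ h → h) |H|′ |H|)

  -- The inclusion induces an injection between enumerations of the same length, hence a surjection;
  -- `respects` transports membership along pointwise equality.
  same-size⇒⊇ : ∀ {H K : PermSet X} → (∀ {σ τ} → σ ≈ₚ τ → H σ → H τ) → (∀ σ → H σ → K σ) →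
                ∀ {a} → HasSize H a → HasSize K a → ∀ σ → K σ → H σ
  same-size⇒⊇ {H} respects H⊆K |H| |K| σ Kσ =
    let j , σ≈kj = proj₂ (proj₂ (proj₂ |K|)) σ Kσ
        i , eq   = injective⇒surjective (embed-injective H⊆K |H| |K|) j
    in respects {lookup (proj₁ |H|) i} {σ}
         (λ x → trans (embed-≈ H⊆K |H| |K| i x) (trans (cong (λ l → app (lookup (proj₁ |K|) l) x) eq) (sym (σ≈kj x))))
         (proj₁ (proj₂ |H|) i)

  enumerate : ∀ {H : PermSet X} {I : Set} {k} → Fin k ↔ I → (e : I → Perm X) → (∀ i → H (e i)) →
              (∀ i j → e i ≈ₚ e j → i ≡ j) → (∀ σ → H σ → ∃ λ i → σ ≈ₚ e i) → HasSize H k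
  enumerate {H} ι e e∈H e-injective e-onto = tabulate (e ∘ to) ,
      (λ i → subst H (sym (look i)) (e∈H (to i))) ,
      (λ i j eq → ↔-injective ι (e-injective (to i) (to j) λ x →
        trans (cong (λ σ → app σ x) (sym (look i))) (trans (eq x) (cong (λ σ → app σ x) (look j))))) ,
      (λ σ Hσ → let i , σ≈ = e-onto σ Hσ in
        from i , λ x → trans (σ≈ x) (cong (λ σ → app σ x) (sym (trans (look (from i)) (cong e (strictlyInverseˡ i))))))
    where
    open Inverse ι
    look : ∀ i → lookup (tabulate (e ∘ to)) i ≡ e (to i)
    look = Vecₚ.lookup∘tabulate (e ∘ to)

  Normalizer-resp : ∀ {A P Q : PermSet X} → (∀ σ → P σ → Q σ) → (∀ σ → Q σ → P σ) →
                    ∀ σ → Normalizer A P σ → Normalizer A Q σ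
  Normalizer-resp P⊆Q Q⊆P σ (aut , norm) = aut , λ τ →
    (λ Qτ → P⊆Q _ (proj₁ (norm τ) (Q⊆P τ Qτ))) , (λ Qc → P⊆Q τ (proj₂ (norm τ) (Q⊆P _ Qc)))

Vec-enumeration : ∀ p n → Fin (p ^ n) ↔ Vec (Fin p) n
Vec-enumeration p zero    = mk↔ₛ′ (λ _ → []) (λ _ → fzero) (λ { [] → refl }) (λ { fzero → refl ; (fsuc ()) })
Vec-enumeration p (suc n) = cons ↔-∘ ((↔-id (Fin p) ×-↔ Vec-enumeration p n) ↔-∘ *↔×)
  where
  cons : (Fin p × Vec (Fin p) n) ↔ Vec (Fin p) (suc n)
  cons = mk↔ₛ′ (λ (x , v) → x ∷ v) uncons (λ { (x ∷ v) → refl }) (λ (x , v) → refl)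

GD-enumeration : ∀ p n → Fin (p ^ n ℕ.* 2) ↔ GD n p
GD-enumeration p n = (Vec-enumeration p n ×-↔ 2↔Bool) ↔-∘ *↔×

prime∣^⇒∣ : ∀ {q} → Prime q → ∀ p k → q ∣ p ^ k → q ∣ p
prime∣^⇒∣ {q} pr p zero    q∣1 = contradiction (subst Prime (∣1⇒≡1 q∣1) pr) ¬prime[1]
prime∣^⇒∣ {q} pr p (suc k) q∣  = [ id , prime∣^⇒∣ pr p k ]′ (euclidsLemma p (p ^ k) pr q∣)

module ΣM = MonoidSum ℕₚ.+-0-commutativeMonoid

-- The numbers of arguments at which b is true and at which it is false are exchanged by j, hence equal.
flip⇒even : ∀ {N} (b : Fin N → Bool) (j : Fin N → Fin N) → Injective _≡_ _≡_ j →
            (∀ i → b (j i) ≡ not (b i)) → 2 ∣ N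
flip⇒even {N} b j j-injective flip = divides (ΣM.sum χ) (begin
  N                                   ≡⟨ ℕₚ.*-identityʳ N ⟨
  N ℕ.* 1                             ≡⟨ ones N ⟨
  ΣM.sum (λ (_ : Fin N) → 1)          ≡⟨ ΣM.sum-cong-≗ (λ i → trans (complement (b i)) (cong (λ c → value (b i) ℕ.+ value c) (sym (flip i)))) ⟩
  ΣM.sum (λ i → χ i ℕ.+ χ (j i))      ≡⟨ ΣM.∑-distrib-+ χ (χ ∘ j) ⟩
  ΣM.sum χ ℕ.+ ΣM.sum (χ ∘ j)         ≡⟨ cong (ΣM.sum χ ℕ.+_) (ΣM.sum-permute χ (injective⇒↔ j-injective)) ⟨
  ΣM.sum χ ℕ.+ ΣM.sum χ               ≡⟨ cong (ΣM.sum χ ℕ.+_) (ℕₚ.+-identityʳ (ΣM.sum χ)) ⟨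
  2 ℕ.* ΣM.sum χ                      ≡⟨ ℕₚ.*-comm 2 (ΣM.sum χ) ⟩
  ΣM.sum χ ℕ.* 2                      ∎)
  where
  open ≡-Reasoning
  value : Bool → ℕ
  value true  = 1
  value false = 0
  χ : Fin N → ℕ
  χ i = value (b i)
  complement : ∀ c → 1 ≡ value c ℕ.+ value (not c)
  complement true  = refl
  complement false = refl
  ones : ∀ k → ΣM.sum (λ (_ : Fin k) → 1) ≡ k ℕ.* 1
  ones zero    = refl
  ones (suc k) = cong suc (ones k)

-- The Sylow p-subgroups of R(G).

module Sylow (n p : ℕ) .{{p≢0 : NonZero p}} (pr : Prime p) where
  open Dihedral n p

  private
    R Rᵥ : PermSet G
    R = RegRep n p
    Rᵥ σ = ∃ λ v → ∀ x → app σ x ≡ x ∙ (v , false)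

    ρ-injective : ∀ {g h} → ρ g ≈ₚ ρ h → g ≡ h
    ρ-injective {g} {h} eq = trans (sym (identityˡ g)) (trans (eq 1ᴳ) (identityˡ h))

  |R| : HasSize R (p ^ n ℕ.* 2)
  |R| = enumerate (GD-enumeration p n) ρ (λ g → g , λ _ → refl) (λ g h → ρ-injective {g} {h}) (λ σ Rσ → Rσ)

  |Rᵥ| : HasSize Rᵥ (p ^ n)
  |Rᵥ| = enumerate (Vec-enumeration p n) (λ v → ρ (v , false)) (λ v → v , λ _ → refl)
    (λ u v eq → cong proj₁ (ρ-injective {u , false} {v , false} eq)) (λ σ Rσ → Rσ)

  module _ (P : PermSet G) (sylow : IsSylow p R P) where
    private
      open IsSubgroup (proj₁ sylow)
      P⊆R : ∀ σ → P σ → R σ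
      P⊆R σ = proj₁ (proj₂ sylow) {σ}
      k = proj₁ (proj₂ (proj₂ sylow))
      m = proj₁ (proj₂ (proj₂ (proj₂ sylow)))
      |P| : HasSize P (p ^ k)
      |P| = proj₁ (proj₂ (proj₂ (proj₂ (proj₂ sylow))))
      p^km≡2p^n : p ^ k ℕ.* m ≡ p ^ n ℕ.* 2
      p^km≡2p^n = size-unique {H = R} (proj₁ (proj₂ (proj₂ (proj₂ (proj₂ (proj₂ sylow)))))) |R|
      p∤m : ¬ p ∣ m
      p∤m = proj₂ (proj₂ (proj₂ (proj₂ (proj₂ (proj₂ sylow)))))

    -- Comparing sizes gives `k ≤ N`. If `k` were smaller, cancelling `p ^ k` would make p divide
    -- `m`. So `P` and `K` have equal size and coincide.
    sylow-maximal : ∀ {K : PermSet G} {N c} → (∀ σ → P σ → K σ) → HasSize K (p ^ N) →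
                    p ^ k ℕ.* m ≡ p ^ N ℕ.* c → ∀ σ → K σ → P σ
    sylow-maximal {K} {N} {c} P⊆K |K| eq = same-size⇒⊇ {H = P} {K = K} (λ {σ} {τ} → respects {σ} {τ}) P⊆K |P|
        (subst (λ N → HasSize K (p ^ N)) N≡k |K|)
      where
      1<p : 1 < p
      1<p = ℕ.nonTrivial⇒n>1 p {{prime⇒nonTrivial pr}}
      k≤N : k ≤ N
      k≤N = ℕₚ.≮⇒≥ λ N<k → ℕₚ.≤⇒≯ (size-mono P⊆K |P| |K|) (ℕₚ.^-monoʳ-< p 1<p N<k)
      N≡k : N ≡ k
      N≡k with N ∸ k in N∸k
      ... | zero  = ℕₚ.≤-antisym (ℕₚ.m∸n≡0⇒m≤n N∸k) k≤N
      ... | suc d = contradiction (subst (p ∣_) (sym m≡) (∣m⇒∣m*n c (m∣m*n (p ^ d)))) p∤m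
        where
        open ≡-Reasoning
        instance _ = ℕₚ.m^n≢0 p k
        m≡ : m ≡ p ^ suc d ℕ.* c
        m≡ = ℕₚ.*-cancelˡ-≡ m (p ^ suc d ℕ.* c) (p ^ k) (begin
          p ^ k ℕ.* m                       ≡⟨ eq ⟩
          p ^ N ℕ.* c                       ≡⟨ cong (λ e → p ^ e ℕ.* c) (trans (sym (ℕₚ.m+[n∸m]≡n k≤N)) (cong (k ℕ.+_) N∸k)) ⟩
          p ^ (k ℕ.+ suc d) ℕ.* c           ≡⟨ cong (ℕ._* c) (ℕₚ.^-distribˡ-+-* p k (suc d)) ⟩
          p ^ k ℕ.* p ^ suc d ℕ.* c         ≡⟨ ℕₚ.*-assoc (p ^ k) (p ^ suc d) c ⟩
          p ^ k ℕ.* (p ^ suc d ℕ.* c)       ∎)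

    -- Left multiplication by an element of P outside Rᵥ flips the parity of the image of 1, so |P| would be even.
    odd⇒P⊆Rᵥ : p ≢ 2 → ∀ σ → P σ → Rᵥ σ
    odd⇒P⊆Rᵥ p≢2 σ Pσ with P⊆R σ Pσ
    ... | (v , false) , σ≗ = v , σ≗
    ... | (v , true)  , σ≗ = contradiction 2≡p (p≢2 ∘ sym)
      where
      e : Fin (p ^ k) → Perm G
      e = lookup (proj₁ |P|)
      next : ∀ i → ∃ λ j → (σ ∘ₚ e i) ≈ₚ e j
      next i = proj₂ (proj₂ (proj₂ |P|)) (σ ∘ₚ e i) (∘-closed {σ} {e i} Pσ (proj₁ (proj₂ |P|) i))
      j = proj₁ ∘ next
      j-injective : Injective _≡_ _≡_ j
      j-injective {a} {b} eq = proj₁ (proj₂ (proj₂ |P|)) a b λ x → ↔-injective σ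
        (trans (proj₂ (next a) x) (trans (cong (λ l → app (e l) x) eq) (sym (proj₂ (next b) x))))
      flip : ∀ i → parity (app (e (j i)) 1ᴳ) ≡ not (parity (app (e i) 1ᴳ))
      flip i = trans (cong parity (trans (sym (proj₂ (next i) 1ᴳ)) (σ≗ (app (e i) 1ᴳ)))) (xor-comm (parity (app (e i) 1ᴳ)) true)
      2≡p : 2 ≡ p
      2≡p = [ (λ ()) , id ]′ (prime⇒irreducible pr (prime∣^⇒∣ prime[2] p k (flip⇒even (λ i → parity (app (e i) 1ᴳ)) j j-injective flip)))

    -- For odd p the group `Rᵥ` has p-power order with cofactor 2 in R(G). For p = 2 all of R(G) has
    -- order `p ^ suc n`, so the cofactor is 1.
    sylow-cases : ((∀ σ → P σ → Rᵥ σ) × (∀ σ → Rᵥ σ → P σ)) ⊎ ((∀ σ → P σ → R σ) × (∀ σ → R σ → P σ))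
    sylow-cases with p ℕ.≟ 2
    ... | no p≢2 = inj₁ (odd⇒P⊆Rᵥ p≢2 , sylow-maximal {K = Rᵥ} {N = n} (odd⇒P⊆Rᵥ p≢2) |Rᵥ| p^km≡2p^n)
    ... | yes p≡2 = inj₂ (P⊆R , sylow-maximal {K = R} {N = suc n} {c = 1} P⊆R
      (subst (HasSize R) (trans (cong (p ^ n ℕ.*_) (sym p≡2)) (ℕₚ.*-comm (p ^ n) p)) |R|)
      (trans p^km≡2p^n (trans (cong (p ^ n ℕ.*_) (sym p≡2)) (trans (ℕₚ.*-comm (p ^ n) p) (sym (ℕₚ.*-identityʳ (p ^ suc n)))))))

-- From a faithful action on the five points to the semidirect decomposition.

-- Faithfulness is `θ-injective`. The neutral element and the inverses are supplied here because
-- `Model` records only equality and product.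
record Action (M : Model) : Set where
  open Model M
  field
    θ           : Carrier → Fin 5 → Fin 5
    θ-cong      : ∀ {x y} → x ≈ y → ∀ i → θ x i ≡ θ y i
    θ-injective : ∀ {x y} → (∀ i → θ x i ≡ θ y i) → x ≈ y
    θ-∙         : ∀ x y i → θ (x ∙ y) i ≡ θ x (θ y i)
    neutral     : Carrier
    θ-neutral   : ∀ i → θ neutral i ≡ i
    inverse     : Carrier → Carrier
    θ-inverseˡ  : ∀ x i → θ (inverse x) (θ x i) ≡ i
    θ-inverseʳ  : ∀ x i → θ x (θ (inverse x) i) ≡ i

-- A self-map of `Fin 5` stored as its list of values, so that statements about all such maps can be
-- decided.
Table : Set
Table = Vec (Fin 5) 5

Collision : Table → Set
Collision t = ∃ λ i → ∃ λ j → i ≢ j × lookup t i ≡ lookup t j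

Realised : ∀ {M k} → Action M → (Fin k → Model.Carrier M) → Table → Set
Realised act x t = ∃ λ a → ∀ i → lookup t i ≡ Action.θ act (x a) i

module Symmetries (n p : ℕ) .{{p≢0 : NonZero p}} (w : Fin 5 → Vec (Fin p) n) (bs : Fin n → Fin 5)
  (w-origin : w fzero ≡ Vectors.0ᵥ p) (w-basis : ∀ j → w (bs j) ≡ Vectors.unit p j)
  (w-injective : Injective _≡_ _≡_ w)
  {M : Model} (act : Action M) where
  open Normalizers n p w bs w-origin w-basis w-injective public
  open Model M hiding (_∙_)
  open Action act

  Complete : Set
  Complete = ∀ π → Injective _≡_ _≡_ π → Admissible π → ∃ λ x → ∀ i → π i ≡ θ x i

  -- Every function on `Fin 5` agrees pointwise with its table, and admissibility respects pointwise
  -- equality, so completeness becomes a check of finitely many tables.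
  complete-by-tables : ∀ {k} (x : Fin k → Carrier) →
    (∀ t → Collision t ⊎ Realised act x t ⊎ ¬ Admissible (lookup t)) → Complete
  complete-by-tables x cases π π-injective adm with cases (tabulate π)
  ... | inj₁ (i , j , i≢j , ti≡tj) = contradiction
          (π-injective (trans (sym (Vecₚ.lookup∘tabulate π i)) (trans ti≡tj (Vecₚ.lookup∘tabulate π j)))) i≢j
  ... | inj₂ (inj₁ (a , t≗θ)) = x a , λ i → trans (sym (Vecₚ.lookup∘tabulate π i)) (t≗θ i)
  ... | inj₂ (inj₂ ¬adm) = contradiction (Admissible-resp (λ i → sym (Vecₚ.lookup∘tabulate π i)) adm) ¬adm

  module _ (admissible : ∀ x → Admissible (θ x)) where

    μ : Carrier → Symmetry
    μ x = record
      { to = θ x ; from = θ (inverse x)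
      ; to-from = θ-inverseʳ x ; from-to = θ-inverseˡ x
      ; to-admissible = admissible x ; from-admissible = admissible (inverse x) }

    -- The complement to R(G), consisting of automorphisms of the group `G`.
    K : PermSet G
    K σ = ∃ λ x → ∀ y → app σ y ≡ Φ (θ x) y

    K-isSubgroup : IsSubgroup K
    K-isSubgroup = record
      { respects  = λ σ≈τ (x , σ≗) → x , λ y → trans (sym (σ≈τ y)) (σ≗ y)
      ; has-id    = neutral , λ y → sym (trans (Φ-cong θ-neutral y) (Φ-id y))
      ; ∘-closed  = λ {σ} (x , σ≗) (x' , τ≗) → Model._∙_ M x x' , λ y → trans (cong (app σ) (τ≗ y)) (trans (σ≗ (Φ (θ x') y))
          (trans (Φ-∘ (admissible x) (θ x') y) (Φ-cong (λ i → sym (θ-∙ x x' i)) y)))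
      ; ⁻¹-closed = λ {σ} (x , σ≗) → inverse x , λ y → ↔-injective σ (trans (Inverse.strictlyInverseˡ σ y)
          (sym (trans (σ≗ (Φ (θ (inverse x)) y)) (Symmetry.Φ-to-from (μ x) y)))) }

    K≅M : IsoTo K M
    K≅M = record
      { f      = λ x → Symmetry.perm (μ x)
      ; f-wd   = λ x y x≈y → Φ-cong (θ-cong x≈y)
      -- The image of `s i` under `Φ (θ x)` is `s (θ x i)`; as the points are distinct, this
      -- determines `θ x`.
      ; f-inj  = λ x y eq → θ-injective λ i → w-injective (cong proj₁
          (trans (sym (Φ-s (admissible x) i)) (trans (eq (s i)) (Φ-s (admissible y) i))))
      ; f-hom  = λ x y z → sym (trans (Φ-∘ (admissible x) (θ y) z) (Φ-cong (λ i → sym (θ-∙ x y i)) z))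
      ; f-into = λ x → x , λ _ → refl
      ; f-onto = λ σ (x , σ≗) → x , σ≗ }

    -- Elements of `K` fix 1, and a right translation is determined by the image of 1.
    K∩R≈1 : ∀ σ → K σ → R σ → σ ≈ₚ idₚ
    K∩R≈1 σ (x , σ≗Φ) (g , σ≗ρ) y = trans (σ≗ρ y) (trans (cong (y ∙_) g≡1) (identityʳ y))
      where
      g≡1 : g ≡ 1ᴳ
      g≡1 = trans (sym (identityˡ g)) (trans (sym (σ≗ρ 1ᴳ)) (trans (σ≗Φ 1ᴳ) (Φ-1 (θ x))))

    holomorphic⇒normalizes-P : Prime p → ∀ P → IsSylow p R P → ∀ μ g σ → Holomorphic μ g σ → Normalizer A P σ
    holomorphic⇒normalizes-P pr P sylow μ g σ σ≗ with Sylow.sylow-cases n p pr P sylow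
    ... | inj₁ (P⊆Rᵥ , Rᵥ⊆P) = Normalizer-resp {A = A} {P = Rᵥ} {Q = P} Rᵥ⊆P P⊆Rᵥ σ (holomorphic⇒normalizes-Rᵥ μ g {σ} σ≗)
    ... | inj₂ (P⊆R , R⊆P)   = Normalizer-resp {A = A} {P = R} {Q = P} R⊆P P⊆R σ (holomorphic⇒normalizes-R μ g {σ} σ≗)

    normalArcTransitive : Prime p → (∀ i j → ∃ λ x → θ x i ≡ j) → NormArcTransitive n p S
    normalArcTransitive pr transitive P sylow =
      arc-transitive {Normalizer A P} (holomorphic⇒normalizes-P pr P sylow) λ i j →
        let x , θi≡j = transitive i j in μ x , θi≡j

    R⊆N : ∀ {σ} → R σ → NR n p S σ
    R⊆N {σ} (g , σ≗) = holomorphic⇒normalizes-R (μ neutral) g {σ} λ y →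
      trans (σ≗ y) (cong (_∙ g) (sym (trans (Φ-cong θ-neutral y) (Φ-id y))))

    K⊆N : ∀ {σ} → K σ → NR n p S σ
    K⊆N {σ} (x , σ≗) = holomorphic⇒normalizes-R (μ x) 1ᴳ {σ} λ y → trans (σ≗ y) (sym (identityʳ (Φ (θ x) y)))

    containsSemidirect : ContainsSemidirect n p (NR n p S) M
    containsSemidirect = K , K-isSubgroup , (λ {σ} → K⊆N {σ}) , K≅M , (λ {σ} → R⊆N {σ}) , K∩R≈1

    module _ (complete : Complete) where

      isSemidirect : IsSemidirect n p (NR n p S) M
      isSemidirect = K , K-isSubgroup , (λ {σ} → K⊆N {σ}) , K≅M , (λ {σ} → R⊆N {σ}) , K∩R≈1 , λ σ Nσ →
        let π , π-injective , adm , g , σ≗ = normalizes-R⇒affine σ Nσ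
            x , π≗θ = complete π π-injective adm
        in ρ g , Symmetry.perm (μ x) , (g , λ _ → refl) , (x , λ _ → refl) ,
           λ y → trans (σ≗ y) (cong (_∙ g) (Φ-cong π≗θ y))

      -- The pairs `(x , g)` parametrise the normaliser: the image of 1 gives back `g`, and
      -- faithfulness then gives `x`. The premise `≈⇒≡` enters because pairs are counted up to
      -- propositional equality.
      normalizer-size : ∀ {k} → Fin k ↔ Carrier → (∀ {x y} → x ≈ y → x ≡ y) → Prime p →
                        ∀ P → IsSylow p R P → HasSize (Normalizer A P) (k ℕ.* (p ^ n ℕ.* 2))
      normalizer-size {k} ι ≈⇒≡ pr P sylow = enumerate {H = Normalizer A P} ((ι ×-↔ GD-enumeration p n) ↔-∘ *↔×) e
        (λ (x , g) → holomorphic⇒normalizes-P pr P sylow (μ x) g (e (x , g)) (λ _ → refl)) e-injective λ σ Nσ →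
          let π , π-injective , adm , g , σ≗ = affine σ Nσ
              x , π≗θ = complete π π-injective adm
          in (x , g) , λ y → trans (σ≗ y) (cong (_∙ g) (Φ-cong π≗θ y))
        where
        e : Carrier × G → Perm G
        e (x , g) = ρ g ∘ₚ Symmetry.perm (μ x)
        affine : ∀ σ → Normalizer A P σ → ∃ λ π → Injective _≡_ _≡_ π × Admissible π × ∃ λ g → ∀ x → app σ x ≡ Φ π x ∙ g
        affine σ Nσ with Sylow.sylow-cases n p pr P sylow
        ... | inj₁ (P⊆Rᵥ , Rᵥ⊆P) = normalizes-Rᵥ⇒affine σ (Normalizer-resp {A = A} {P = P} {Q = Rᵥ} P⊆Rᵥ Rᵥ⊆P σ Nσ)
        ... | inj₂ (P⊆R , R⊆P)   = normalizes-R⇒affine σ (Normalizer-resp {A = A} {P = P} {Q = R} P⊆R R⊆P σ Nσ)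
        e-injective : ∀ a b → e a ≈ₚ e b → a ≡ b
        e-injective (x , g) (y , h) eq = cong₂ _,_ (≈⇒≡ (IsoTo.f-inj K≅M x y λ z → ∙-cancelʳ g _ _
            (trans (eq z) (cong (Φ (θ y) z ∙_) (sym g≡h))))) g≡h
          where
          g≡h : g ≡ h
          g≡h = begin
            g                   ≡⟨ identityˡ g ⟨
            1ᴳ ∙ g              ≡⟨ cong (_∙ g) (Φ-1 (θ x)) ⟨
            Φ (θ x) 1ᴳ ∙ g      ≡⟨ eq 1ᴳ ⟩
            Φ (θ y) 1ᴳ ∙ h      ≡⟨ cong (_∙ h) (Φ-1 (θ y)) ⟩
            1ᴳ ∙ h              ≡⟨ identityˡ h ⟩
            h                   ∎
            where open ≡-Reasoning

-- Exact arithmetic in a monogenic extension of ℤ.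

-- Elements of ℤ[x]/(x^(1+d) − r) are given by their coefficients, starting with the constant one.
module IntegerAlgebra {d : ℕ} (r : Vec ℤ (suc d)) where

  B : Set
  B = Vec ℤ (suc d)

  infixl 6 _+ᴮ_ _⊟_
  infixl 7 _*ᴮ_

  _+ᴮ_ _⊟_ : B → B → B
  _+ᴮ_ = zipWith ℤ._+_
  _⊟_  = zipWith ℤ._-_

  0ᴮ : B
  0ᴮ = replicate (suc d) 0ℤ

  const : ℤ → B
  const c = c ∷ replicate d 0ℤ

  scale : ℤ → B → B
  scale c = map (c ℤ.*_)

  -- Multiplication by x before reduction: the second component is the leading coefficient that
  -- overflows and that `times-x` replaces by a multiple of `r`.
  push : ∀ {k} → ℤ → Vec ℤ k → Vec ℤ k × ℤ
  push c []       = [] , c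
  push c (a ∷ as) = c ∷ proj₁ (push a as) , proj₂ (push a as)

  times-x : B → B
  times-x a = proj₁ (push 0ℤ a) +ᴮ scale (proj₂ (push 0ℤ a)) r

  -- Horner's scheme in the left factor, whose length varies so that the recursion can run over its
  -- tail.
  _*ᴮ_ : ∀ {k} → Vec ℤ k → B → B
  []       *ᴮ b = 0ᴮ
  (a ∷ as) *ᴮ b = scale a b +ᴮ times-x (as *ᴮ b)

  -- Substitution of `β` for x; for another root `β` of the defining equation this is a Galois
  -- conjugate.
  at : ∀ {k} → Vec ℤ k → B → B
  at []       β = 0ᴮ
  at (a ∷ as) β = const a +ᴮ β *ᴮ at as β

  -- If xs lists the conjugates of x other than x, this is the norm of a divided by a.
  cofactor : List B → B → B
  cofactor xs a = foldr (λ x b → at a x *ᴮ b) (const 1ℤ) xs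

  linᴮ : ∀ {n m} → (Fin n → Vec B m) → Vec B n → Vec B m
  linᴮ {m = m} b []      = replicate m 0ᴮ
  linᴮ         b (x ∷ v) = zipWith _+ᴮ_ (map (x *ᴮ_) (b fzero)) (linᴮ (b ∘ fsuc) v)

  -- A certificate that `a` stays nonzero modulo primes other than 5: its product with the cofactor
  -- is an integer dividing `5 ^ 4`. The exponent 4 suffices for all elements certified below.
  record UnitAwayFrom5 (xs : List B) (a : B) : Set where
    constructor unit
    field
      constant : tail (a *ᴮ cofactor xs a) ≡ replicate d 0ℤ
      power-of-5 : ∣ head (a *ᴮ cofactor xs a) ∣ ∣ 5 ^ 4

  unitAwayFrom5? : ∀ xs a → Dec (UnitAwayFrom5 xs a)
  unitAwayFrom5? xs a = map′ (λ (c , k) → unit c k) (λ (unit c k) → c , k)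
    (Vecₚ.≡-dec ℤ._≟_ _ _ ×-dec (_ ∣? _))

-- Evaluation of the exact ring in ℤ_p.

module Evaluation (p : ℕ) .{{p≢0 : NonZero p}} {d : ℕ} (r : Vec ℤ (suc d)) where
  open Residues p
  open IntegerAlgebra r
  open RingSolver (fromCommutativeRing ℤ/p (λ _ → nothing)) using (solve; _⊜_)
    renaming (_⊕_ to _:+_; _⊗_ to _:*_; ⊝_ to :-_)
  open ≡-Reasoning

  -- The ring homomorphism from ℤ to ℤ_p.
  ι : ℤ → Fin p
  ι (+ n)    = zp p n
  ι -[1+ n ] = negZ p (zp p (suc n))

  ι-⊖ : ∀ m n → ι (m ℤ.⊖ n) ≡ zp p m ⊕ negZ p (zp p n)
  ι-⊖ zero    zero    = sym (-‿inverseʳ (zp p 0))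
  ι-⊖ zero    (suc n) = sym (⊕-identityˡ _)
  ι-⊖ (suc m) zero    = sym (trans (cong (zp p (suc m) ⊕_) -0#≈0#) (+-identityʳ _))
  ι-⊖ (suc m) (suc n) = begin
    ι (suc m ℤ.⊖ suc n)                                     ≡⟨ cong ι (ℤₚ.[1+m]⊖[1+n]≡m⊖n m n) ⟩
    ι (m ℤ.⊖ n)                                             ≡⟨ ι-⊖ m n ⟩
    zp p m ⊕ negZ p (zp p n)                                ≡⟨ translate (zp p 1) (zp p m) (zp p n) ⟨
    (zp p 1 ⊕ zp p m) ⊕ negZ p (zp p 1 ⊕ zp p n)            ≡⟨ cong₂ (λ a b → a ⊕ negZ p b) (zp-+ 1 m) (zp-+ 1 n) ⟩
    zp p (suc m) ⊕ negZ p (zp p (suc n))                    ∎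
    where
    translate : ∀ o a b → (o ⊕ a) ⊕ negZ p (o ⊕ b) ≡ a ⊕ negZ p b
    translate o a b = begin
      (o ⊕ a) ⊕ negZ p (o ⊕ b)              ≡⟨ cong ((o ⊕ a) ⊕_) (-‿+-comm o b) ⟨
      (o ⊕ a) ⊕ (negZ p o ⊕ negZ p b)       ≡⟨ solve 4 (λ o o′ a b′ → ((o :+ a) :+ (o′ :+ b′)) ⊜ ((o :+ o′) :+ (a :+ b′))) refl o (negZ p o) a (negZ p b) ⟩
      (o ⊕ negZ p o) ⊕ (a ⊕ negZ p b)       ≡⟨ cong (_⊕ (a ⊕ negZ p b)) (-‿inverseʳ o) ⟩
      zp p 0 ⊕ (a ⊕ negZ p b)               ≡⟨ ⊕-identityˡ _ ⟩
      a ⊕ negZ p b                          ∎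

  ι-+ : ∀ a b → ι (a ℤ.+ b) ≡ ι a ⊕ ι b
  ι-+ (+ m)    (+ n)    = sym (zp-+ m n)
  ι-+ (+ m)    -[1+ n ] = ι-⊖ m (suc n)
  ι-+ -[1+ m ] (+ n)    = trans (ι-⊖ n (suc m)) (⊕-comm (zp p n) (negZ p (zp p (suc m))))
  ι-+ -[1+ m ] -[1+ n ] = begin
    negZ p (zp p (suc (suc (m ℕ.+ n))))                     ≡⟨ cong (λ k → negZ p (zp p (suc k))) (ℕₚ.+-suc m n) ⟨
    negZ p (zp p (suc m ℕ.+ suc n))                         ≡⟨ cong (negZ p) (zp-+ (suc m) (suc n)) ⟨
    negZ p (zp p (suc m) ⊕ zp p (suc n))                    ≡⟨ -‿+-comm (zp p (suc m)) (zp p (suc n)) ⟨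
    negZ p (zp p (suc m)) ⊕ negZ p (zp p (suc n))           ∎

  ι-neg : ∀ a → ι (ℤ.- a) ≡ negZ p (ι a)
  ι-neg (+ zero)  = sym -0#≈0#
  ι-neg (+ suc n) = refl
  ι-neg -[1+ n ]  = sym (-‿involutive _)

  ι-+* : ∀ m b → ι (+ m ℤ.* b) ≡ zp p m ⊗ ι b
  ι-+* zero    b = trans (cong ι (ℤₚ.*-zeroˡ b)) (sym (zeroˡ (ι b)))
  ι-+* (suc m) b = begin
    ι (+ suc m ℤ.* b)             ≡⟨ cong ι (ℤₚ.suc-* (+ m) b) ⟩
    ι (b ℤ.+ + m ℤ.* b)           ≡⟨ ι-+ b (+ m ℤ.* b) ⟩
    ι b ⊕ ι (+ m ℤ.* b)           ≡⟨ cong (ι b ⊕_) (ι-+* m b) ⟩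
    ι b ⊕ zp p m ⊗ ι b            ≡⟨ cong (_⊕ zp p m ⊗ ι b) (⊗-identityˡ (ι b)) ⟨
    zp p 1 ⊗ ι b ⊕ zp p m ⊗ ι b   ≡⟨ distribʳ (ι b) (zp p 1) (zp p m) ⟨
    (zp p 1 ⊕ zp p m) ⊗ ι b       ≡⟨ cong (_⊗ ι b) (zp-+ 1 m) ⟩
    zp p (suc m) ⊗ ι b            ∎

  ι-* : ∀ a b → ι (a ℤ.* b) ≡ ι a ⊗ ι b
  ι-* (+ m)     b = ι-+* m b
  ι-* -[1+ m ]  b = begin
    ι (-[1+ m ] ℤ.* b)            ≡⟨ cong ι (ℤₚ.neg-distribˡ-* (+ suc m) b) ⟨
    ι (ℤ.- (+ suc m ℤ.* b))       ≡⟨ ι-neg (+ suc m ℤ.* b) ⟩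
    negZ p (ι (+ suc m ℤ.* b))    ≡⟨ cong (negZ p) (ι-+* (suc m) b) ⟩
    negZ p (ι (+ suc m) ⊗ ι b)    ≡⟨ -‿distribˡ-* (ι (+ suc m)) (ι b) ⟩
    ι -[1+ m ] ⊗ ι b              ∎

  ι≡0⇒∣ : ∀ a → ι a ≡ zp p 0 → p ∣ ∣ a ∣
  ι≡0⇒∣ (+ n)    eq = zp≡0⇒∣ eq
  ι≡0⇒∣ -[1+ n ] eq = zp≡0⇒∣ (trans (sym (-‿involutive _)) (trans (cong (negZ p) eq) -0#≈0#))

  module _ (x : Fin p) where

    eval : ∀ {k} → Vec ℤ k → Fin p
    eval []       = zp p 0
    eval (a ∷ as) = ι a ⊕ x ⊗ eval as

    pow : ℕ → Fin p
    pow zero    = zp p 1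
    pow (suc k) = x ⊗ pow k

    eval-+ : ∀ {k} (a b : Vec ℤ k) → eval (zipWith ℤ._+_ a b) ≡ eval a ⊕ eval b
    eval-+ []       []       = sym (⊕-identityˡ (zp p 0))
    eval-+ (a ∷ as) (b ∷ bs) = trans (cong₂ (λ s t → s ⊕ x ⊗ t) (ι-+ a b) (eval-+ as bs))
      (solve 5 (λ x a b u v → ((a :+ b) :+ (x :* (u :+ v))) ⊜ ((a :+ (x :* u)) :+ (b :+ (x :* v)))) refl
        x (ι a) (ι b) (eval as) (eval bs))

    eval-neg : ∀ {k} (a : Vec ℤ k) → eval (map ℤ.-_ a) ≡ negZ p (eval a)
    eval-neg []       = sym -0#≈0#
    eval-neg (a ∷ as) = trans (cong₂ (λ s t → s ⊕ x ⊗ t) (ι-neg a) (eval-neg as))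
      (trans (cong (negZ p (ι a) ⊕_) (sym (-‿distribʳ-* x (eval as)))) (-‿+-comm (ι a) (x ⊗ eval as)))

    eval-⊟ : ∀ {k} (a b : Vec ℤ k) → eval (zipWith ℤ._-_ a b) ≡ eval a ⊕ negZ p (eval b)
    eval-⊟ a b = trans (cong eval (sym (Vecₚ.zipWith-map₂ ℤ._+_ ℤ.-_ a b)))
      (trans (eval-+ a (map ℤ.-_ b)) (cong (eval a ⊕_) (eval-neg b)))

    eval-scale : ∀ {k} c (a : Vec ℤ k) → eval (map (c ℤ.*_) a) ≡ ι c ⊗ eval a
    eval-scale c []       = sym (zeroʳ (ι c))
    eval-scale c (a ∷ as) = trans (cong₂ (λ s t → s ⊕ x ⊗ t) (ι-* c a) (eval-scale c as))
      (solve 4 (λ x c a u → ((c :* a) :+ (x :* (c :* u))) ⊜ (c :* (a :+ (x :* u)))) refl x (ι c) (ι a) (eval as))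

    eval-0 : ∀ k → eval (replicate k 0ℤ) ≡ zp p 0
    eval-0 zero    = refl
    eval-0 (suc k) = trans (⊕-identityˡ _) (trans (cong (x ⊗_) (eval-0 k)) (zeroʳ x))

    eval-const : ∀ c k → eval (c ∷ replicate k 0ℤ) ≡ ι c
    eval-const c k = trans (cong (λ t → ι c ⊕ x ⊗ t) (eval-0 k)) (trans (cong (ι c ⊕_) (zeroʳ x)) (+-identityʳ (ι c)))

    -- The overflow is weighted by `pow k`. At full length `root` turns this weight into the value
    -- of `r`, which gives `eval-times-x`.
    eval-push : ∀ {k} c (a : Vec ℤ k) → eval (proj₁ (push c a)) ⊕ ι (proj₂ (push c a)) ⊗ pow k ≡ ι c ⊕ x ⊗ eval a
    eval-push c []       = trans (⊕-identityˡ _) (trans (*-identityʳ (ι c)) (sym (trans (cong (ι c ⊕_) (zeroʳ x)) (+-identityʳ (ι c)))))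
    eval-push {suc k} c (a ∷ as) = trans
      (solve 5 (λ x c u t y → ((c :+ (x :* u)) :+ (t :* (x :* y))) ⊜ (c :+ (x :* (u :+ (t :* y))))) refl
        x (ι c) (eval (proj₁ (push a as))) (ι (proj₂ (push a as))) (pow k))
      (cong (λ t → ι c ⊕ x ⊗ t) (eval-push a as))

    module _ (root : eval r ≡ pow (suc d)) where

      eval-times-x : ∀ a → eval (times-x a) ≡ x ⊗ eval a
      eval-times-x a = begin
        eval (times-x a)                                  ≡⟨ eval-+ (proj₁ (push 0ℤ a)) (scale t r) ⟩
        eval (proj₁ (push 0ℤ a)) ⊕ eval (scale t r)       ≡⟨ cong (eval (proj₁ (push 0ℤ a)) ⊕_) (trans (eval-scale t r) (cong (ι t ⊗_) root)) ⟩
        eval (proj₁ (push 0ℤ a)) ⊕ ι t ⊗ pow (suc d)      ≡⟨ eval-push 0ℤ a ⟩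
        zp p 0 ⊕ x ⊗ eval a                               ≡⟨ ⊕-identityˡ _ ⟩
        x ⊗ eval a                                        ∎
        where t = proj₂ (push 0ℤ a)

      -- At a root of the defining equation, evaluation respects the reduction in `times-x`; the
      -- induction follows Horner's scheme.
      eval-* : ∀ {k} (a : Vec ℤ k) b → eval (a *ᴮ b) ≡ eval a ⊗ eval b
      eval-* []       b = trans (eval-0 (suc d)) (sym (zeroˡ (eval b)))
      eval-* (a ∷ as) b = begin
        eval (scale a b +ᴮ times-x (as *ᴮ b))             ≡⟨ eval-+ (scale a b) (times-x (as *ᴮ b)) ⟩
        eval (scale a b) ⊕ eval (times-x (as *ᴮ b))       ≡⟨ cong₂ _⊕_ (eval-scale a b) (trans (eval-times-x (as *ᴮ b)) (cong (x ⊗_) (eval-* as b))) ⟩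
        ι a ⊗ eval b ⊕ x ⊗ (eval as ⊗ eval b)             ≡⟨ cong (ι a ⊗ eval b ⊕_) (⊗-assoc x (eval as) (eval b)) ⟨
        ι a ⊗ eval b ⊕ (x ⊗ eval as) ⊗ eval b             ≡⟨ distribʳ (eval b) (ι a) (x ⊗ eval as) ⟨
        (ι a ⊕ x ⊗ eval as) ⊗ eval b                      ∎

      -- If `a` evaluated to 0, so would the integer in the certificate; then p would divide `5 ^ 4`
      -- and be 5.
      unit⇒≢0 : Prime p → p ≢ 5 → ∀ xs a → UnitAwayFrom5 xs a → eval a ≢ zp p 0
      unit⇒≢0 pr p≢5 xs a (unit constant power) a≡0 = p≢5 ([ (λ p≡1 → contradiction (subst Prime p≡1 pr) ¬prime[1]) , id ]′
          (prime⇒irreducible (from-yes (prime? 5)) (prime∣^⇒∣ pr 5 4 (∣-trans (ι≡0⇒∣ (head b) b₀≡0) power))))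
        where
        b = a *ᴮ cofactor xs a
        b₀≡0 : ι (head b) ≡ zp p 0
        b₀≡0 = begin
          ι (head b)                              ≡⟨ eval-const (head b) d ⟨
          eval (head b ∷ replicate d 0ℤ)          ≡⟨ cong (λ t → eval (head b ∷ t)) constant ⟨
          eval (head b ∷ tail b)                  ≡⟨ cong eval (η b) ⟩
          eval b                                  ≡⟨ eval-* a (cofactor xs a) ⟩
          eval a ⊗ eval (cofactor xs a)           ≡⟨ cong (_⊗ eval (cofactor xs a)) a≡0 ⟩
          zp p 0 ⊗ eval (cofactor xs a)           ≡⟨ zeroˡ _ ⟩
          zp p 0                                  ∎
          where
          η : ∀ (b : Vec ℤ (suc d)) → head b ∷ tail b ≡ b
          η (_ ∷ _) = refl

      open Vectors p using (_+ᵥ_; _·_; lin; 0ᵥ)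

      eval-lin : ∀ {n m} (b : Fin n → Vec B m) v → map eval (linᴮ b v) ≡ lin (map eval ∘ b) (map eval v)
      eval-lin {m = m} b []      = trans (Vecₚ.map-replicate eval 0ᴮ m) (cong (replicate m) (eval-0 (suc d)))
      eval-lin         b (a ∷ v) = trans (map-zip (map (a *ᴮ_) (b fzero)) (linᴮ (b ∘ fsuc) v))
          (cong₂ _+ᵥ_ (map-scale (b fzero)) (eval-lin (b ∘ fsuc) v))
        where
        map-zip : ∀ {m} (u v : Vec B m) → map eval (zipWith _+ᴮ_ u v) ≡ map eval u +ᵥ map eval v
        map-zip []      []      = refl
        map-zip (a ∷ u) (b ∷ v) = cong₂ _∷_ (eval-+ a b) (map-zip u v)
        map-scale : ∀ {m} (u : Vec B m) → map eval (map (a *ᴮ_) u) ≡ eval a · map eval u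
        map-scale []      = refl
        map-scale (b ∷ u) = cong₂ _∷_ (eval-* a b) (map-scale u)

-- Decision procedures and the actions of the four model groups on five points.

all-vec? : ∀ {m} k {P : Vec (Fin m) k → Set} → (∀ v → Dec (P v)) → Dec (∀ v → P v)
all-vec? zero    P? = map′ (λ { P[] [] → P[] }) (λ P → P []) (P? [])
all-vec? (suc k) P? = map′ (λ { P (x ∷ v) → P x v }) (λ P x v → P (x ∷ v)) (all? λ x → all-vec? k λ v → P? (x ∷ v))

allᵇ? : {P : Bool → Set} → (∀ b → Dec (P b)) → Dec (∀ b → P b)
allᵇ? P? = map′ (λ { (f , t) false → f ; (f , t) true → t }) (λ P → P false , P true) (P? false ×-dec P? true)

collision? : ∀ t → Dec (Collision t)
collision? t = any? λ i → any? λ j → ¬? (i ≟ᶠ j) ×-dec (lookup t i ≟ᶠ lookup t j)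

realised? : ∀ {M k} (act : Action M) (x : Fin k → Model.Carrier M) t → Dec (Realised act x t)
realised? act x t = any? λ a → all? λ i → lookup t i ≟ᶠ Action.θ act (x a) i

Z5-action : Action Z5
Z5-action = record
  { θ           = θ
  ; θ-cong      = λ { refl i → refl }
  ; θ-injective = λ {x} {y} → from-yes (all? λ x → all? λ y → (all? λ i → θ x i ≟ᶠ θ y i) →-dec (x ≟ᶠ y)) x y
  ; θ-∙         = from-yes (all? λ x → all? λ y → all? λ i → θ (addZ 5 x y) i ≟ᶠ θ x (θ y i))
  ; neutral     = 0F
  ; θ-neutral   = from-yes (all? λ i → θ 0F i ≟ᶠ i)
  ; inverse     = negZ 5
  ; θ-inverseˡ  = from-yes (all? λ x → all? λ i → θ (negZ 5 x) (θ x i) ≟ᶠ i)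
  ; θ-inverseʳ  = from-yes (all? λ x → all? λ i → θ x (θ (negZ 5 x) i) ≟ᶠ i) }
  where
  θ : Fin 5 → Fin 5 → Fin 5
  θ = addZ 5

Z5-transitive : ∀ i j → ∃ λ x → Action.θ Z5-action x i ≡ j
Z5-transitive = from-yes (all? λ i → all? λ j → any? λ x → Action.θ Z5-action x i ≟ᶠ j)

-- The symmetries i ↦ b ± i of a pentagon with vertices labelled by ℤ_5.
D5-action : Action D5
D5-action = record
  { θ           = λ { (b ∷ [] , e) → θ b e }
  ; θ-cong      = λ { refl i → refl }
  ; θ-injective = λ { {b ∷ [] , e} {c ∷ [] , f} eq →
                    let b≡c , e≡f = injective b e c f eq in cong₂ (λ b e → b ∷ [] , e) b≡c e≡f }
  -- The split on the flag of the left factor lets the conditional in `gdMul` compute.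
  ; θ-∙         = λ { (b ∷ [] , false) (c ∷ [] , f) → hom b false c f
                    ; (b ∷ [] , true)  (c ∷ [] , f) → hom b true c f }
  ; neutral     = 0F ∷ [] , false
  ; θ-neutral   = from-yes (all? λ i → θ 0F false i ≟ᶠ i)
  ; inverse     = λ { (b ∷ [] , e) → inv b e ∷ [] , e }
  ; θ-inverseˡ  = λ { (b ∷ [] , e) → inverseˡ b e }
  ; θ-inverseʳ  = λ { (b ∷ [] , e) → inverseʳ b e } }
  where
  θ : Fin 5 → Bool → Fin 5 → Fin 5
  θ b e i = addZ 5 b (if e then negZ 5 i else i)
  inv : Fin 5 → Bool → Fin 5
  inv b e = if e then b else negZ 5 b
  injective = from-yes (all? λ b → allᵇ? λ e → all? λ c → allᵇ? λ f →
    (all? λ i → θ b e i ≟ᶠ θ c f i) →-dec ((b ≟ᶠ c) ×-dec (e ≟ᵇ f)))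
  hom = from-yes (all? λ b → allᵇ? λ e → all? λ c → allᵇ? λ f → all? λ i →
    θ (addZ 5 b (if e then negZ 5 c else c)) (e xor f) i ≟ᶠ θ b e (θ c f i))
  inverseˡ = from-yes (all? λ b → allᵇ? λ e → all? λ i → θ (inv b e) e (θ b e i) ≟ᶠ i)
  inverseʳ = from-yes (all? λ b → allᵇ? λ e → all? λ i → θ b e (θ (inv b e) e i) ≟ᶠ i)

D5-transitive : ∀ i j → ∃ λ x → Action.θ D5-action x i ≡ j
D5-transitive i j = let x , eq = Z5-transitive i j in (x ∷ [] , false) , eq

F20-action : Action F20
F20-action = record
  { θ           = θ
  ; θ-cong      = λ { refl i → refl }
  ; θ-injective = λ {(b , k)} {(c , l)} → from-yes (all? λ b → all? λ k → all? λ c → all? λ l →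
                    (all? λ i → θ (b , k) i ≟ᶠ θ (c , l) i) →-dec
                    map′ (λ (b≡c , k≡l) → cong₂ _,_ b≡c k≡l) (λ { refl → refl , refl }) ((b ≟ᶠ c) ×-dec (k ≟ᶠ l))) b k c l
  ; θ-∙         = λ (b , k) (c , l) → from-yes (all? λ b → all? λ k → all? λ c → all? λ l → all? λ i →
                    θ (Model._∙_ F20 (b , k) (c , l)) i ≟ᶠ θ (b , k) (θ (c , l) i)) b k c l
  ; neutral     = 0F , 0F
  ; θ-neutral   = from-yes (all? λ i → θ (0F , 0F) i ≟ᶠ i)
  ; inverse     = inv
  ; θ-inverseˡ  = λ (b , k) → from-yes (all? λ b → all? λ k → all? λ i → θ (inv (b , k)) (θ (b , k) i) ≟ᶠ i) b k
  ; θ-inverseʳ  = λ (b , k) → from-yes (all? λ b → all? λ k → all? λ i → θ (b , k) (θ (inv (b , k)) i) ≟ᶠ i) b k }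
  where
  θ : Fin 5 × Fin 4 → Fin 5 → Fin 5
  θ (b , k) i = addZ 5 (mulZ 5 (fsuc k) i) b
  -- The inverse of a in the multiplicative group of order 4 is a³.
  inv : Fin 5 × Fin 4 → Fin 5 × Fin 4
  inv (b , k) = negZ 5 (mulZ 5 k⁻¹ b) , unit5 k⁻¹
    where k⁻¹ = mulZ 5 (fsuc k) (mulZ 5 (fsuc k) (fsuc k))

F20-transitive : ∀ i j → ∃ λ x → Action.θ F20-action x i ≡ j
F20-transitive i j =
  let x , eq = from-yes (all? λ i → all? λ j → any? λ b → Action.θ F20-action (b , 0F) i ≟ᶠ j) i j in (x , 0F) , eq

S5-action : Action S5
S5-action = record
  { θ           = app
  ; θ-cong      = λ x≈y → x≈y
  ; θ-injective = λ x≈y → x≈y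
  ; θ-∙         = λ _ _ _ → refl
  ; neutral     = idₚ
  ; θ-neutral   = λ _ → refl
  ; inverse     = _⁻¹ₚ
  ; θ-inverseˡ  = Inverse.strictlyInverseʳ
  ; θ-inverseʳ  = Inverse.strictlyInverseˡ }

S5-transitive : ∀ i j → ∃ λ x → Action.θ S5-action x i ≡ j
S5-transitive i j =
  let x , eq = Z5-transitive i j
  in mk↔ₛ′ (θ x) (θ (inverse x)) (θ-inverseʳ x) (θ-inverseˡ x) , eq
  where open Action Z5-action

-- Certificates for five points with coordinates in ℤ[ζ] or ℤ[φ].

module Pentad {d : ℕ} (r : Vec ℤ (suc d)) {n : ℕ} (ŵ : Fin 5 → Vec (Vec ℤ (suc d)) n) (bs : Fin n → Fin 5)
  (xs : List (Vec ℤ (suc d))) where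
  open IntegerAlgebra r

  difference : Vec B n → Vec B n → Vec B n
  difference = zipWith _⊟_

  -- The error in the admissibility equation at index `i`, computed in the exact ring.
  residual : (Fin 5 → Fin 5) → Fin 5 → Vec B n
  residual π i = difference
    (zipWith _+ᴮ_ (linᴮ (λ j → difference (ŵ (π (bs j))) (ŵ (π 0F))) (ŵ i)) (ŵ (π 0F)))
    (ŵ (π i))

  Exact : (Fin 5 → Fin 5) → Set
  Exact π = ∀ i → residual π i ≡ replicate n 0ᴮ

  exact? : ∀ π → Dec (Exact π)
  exact? π = all? λ i → Vecₚ.≡-dec (Vecₚ.≡-dec ℤ._≟_) _ _

  Distinct : Vec B n → Vec B n → Set
  Distinct u v = VecAny.Any (UnitAwayFrom5 xs) (difference u v)

  distinct? : ∀ u v → Dec (Distinct u v)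
  distinct? u v = VecAny.any? (unitAwayFrom5? xs) (difference u v)

  -- Admissibility would make all residuals evaluate to 0, so one pair with a certified difference
  -- refutes it. For the configurations below the point of index 0 is the origin and its residual is
  -- 0, so a pair `(i , 0F)` tests the residual at `i` itself.
  Rigid : List (Fin 5 × Fin 5) → (Fin 5 → Fin 5) → Set
  Rigid pairs π = Any (λ (i , j) → Distinct (residual π i) (residual π j)) pairs

  rigid? : ∀ pairs π → Dec (Rigid pairs π)
  rigid? pairs π = Any.any? (λ (i , j) → distinct? (residual π i) (residual π j)) pairs

  Separated : Set
  Separated = ∀ i j → i ≡ j ⊎ Distinct (ŵ i) (ŵ j)

  separated? : Dec Separated
  separated? = all? λ i → all? λ j → (i ≟ᶠ j) ⊎-dec distinct? (ŵ i) (ŵ j)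

module Cyclotomic where
  r : Vec ℤ 4
  r = replicate 4 (ℤ.- 1ℤ)

  -- The inverses are integral: ζ⁻¹ = ζ⁴, which is `r`, and (1 + ζ)(-ζ - ζ³) = 1.
  ζ 1+ζ ζ⁻¹ [1+ζ]⁻¹ ζ[1+ζ]⁻¹ : Vec ℤ 4
  ζ        = 0ℤ ∷ 1ℤ ∷ 0ℤ ∷ 0ℤ ∷ []
  1+ζ      = 1ℤ ∷ 1ℤ ∷ 0ℤ ∷ 0ℤ ∷ []
  ζ⁻¹      = r
  [1+ζ]⁻¹  = 0ℤ ∷ -[1+ 0 ] ∷ 0ℤ ∷ -[1+ 0 ] ∷ []
  ζ[1+ζ]⁻¹ = 1ℤ ∷ 1ℤ ∷ 0ℤ ∷ 1ℤ ∷ []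

  open IntegerAlgebra r

  1ᴮ : B
  1ᴮ = const 1ℤ

  conjugates : List B
  conjugates = (0ℤ ∷ 0ℤ ∷ 1ℤ ∷ 0ℤ ∷ []) ∷ (0ℤ ∷ 0ℤ ∷ 0ℤ ∷ 1ℤ ∷ []) ∷ r ∷ []

  points₁ : Vec (Vec B 2) 5
  points₁ = (0ᴮ ∷ 0ᴮ ∷ []) ∷ (1ᴮ ∷ 0ᴮ ∷ []) ∷ (ζ[1+ζ]⁻¹ ∷ ζ⁻¹ ∷ []) ∷ (ζ ∷ [1+ζ]⁻¹ ∷ []) ∷ (0ᴮ ∷ 1ᴮ ∷ []) ∷ []

  basis₁ : Fin 2 → Fin 5
  basis₁ = lookup (1F ∷ 4F ∷ [])

  module P₁ = Pentad r (lookup points₁) basis₁ conjugates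

  abstract
    -- The points are listed in cyclic order, so the rotations of the indices extend to affine maps.
    -- `abstract` keeps the check from being unfolded later.
    exact₁ : ∀ x → P₁.Exact (Action.θ Z5-action x)
    exact₁ = from-yes (all? λ x → P₁.exact? (Action.θ Z5-action x))

  abstract
    separated₁ : P₁.Separated
    separated₁ = from-yes P₁.separated?

  -- Only the points 2 and 3 lie outside the affine basis, so only their residuals can be nonzero;
  -- each of them, or their difference, may serve as the witness.
  pairs₁ : List (Fin 5 × Fin 5)
  pairs₁ = (2F , 0F) ∷ (3F , 0F) ∷ (3F , 2F) ∷ []

  abstract
    rigid₁ : ∀ t → Collision t ⊎ Realised Z5-action id t ⊎ P₁.Rigid pairs₁ (lookup t)
    rigid₁ = from-yes (all-vec? 5 λ t → collision? t ⊎-dec realised? Z5-action id t ⊎-dec P₁.rigid? pairs₁ (lookup t))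

  points₃ : Vec (Vec B 3) 5
  points₃ = (0ᴮ ∷ 0ᴮ ∷ 0ᴮ ∷ []) ∷ (1ᴮ ∷ 0ᴮ ∷ 0ᴮ ∷ []) ∷ (0ᴮ ∷ 1ᴮ ∷ 0ᴮ ∷ []) ∷
            (map ℤ.-_ (ζ *ᴮ ζ) ∷ map ℤ.-_ ζ ∷ map ℤ.-_ ζ⁻¹ ∷ []) ∷ (0ᴮ ∷ 0ᴮ ∷ 1ᴮ ∷ []) ∷ []

  basis₃ : Fin 3 → Fin 5
  basis₃ = lookup (1F ∷ 2F ∷ 4F ∷ [])

  module P₃ = Pentad r (lookup points₃) basis₃ conjugates

  abstract
    exact₃ : ∀ x → P₃.Exact (Action.θ Z5-action x)
    exact₃ = from-yes (all? λ x → P₃.exact? (Action.θ Z5-action x))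

  abstract
    separated₃ : P₃.Separated
    separated₃ = from-yes P₃.separated?

module Golden where
  r φ : Vec ℤ 2
  r = 1ℤ ∷ 1ℤ ∷ []
  φ = 0ℤ ∷ 1ℤ ∷ []

  open IntegerAlgebra r

  1ᴮ : B
  1ᴮ = const 1ℤ

  conjugates : List B
  conjugates = (1ℤ ∷ -[1+ 0 ] ∷ []) ∷ []

  -- A regular pentagon in the affine frame of its consecutive vertices 1, 0 and 4, which explains
  -- its dihedral symmetry.
  points : Vec (Vec B 2) 5
  points = (0ᴮ ∷ 0ᴮ ∷ []) ∷ (1ᴮ ∷ 0ᴮ ∷ []) ∷ (φ ∷ 1ᴮ ∷ []) ∷ (1ᴮ ∷ φ ∷ []) ∷ (0ᴮ ∷ 1ᴮ ∷ []) ∷ []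

  basis : Fin 2 → Fin 5
  basis = lookup (1F ∷ 4F ∷ [])

  module P = Pentad r (lookup points) basis conjugates

  D5-elements : Fin 10 ↔ GD 1 5
  D5-elements = GD-enumeration 5 1

  abstract
    exact : ∀ b e → P.Exact (Action.θ D5-action (b ∷ [] , e))
    exact = from-yes (all? λ b → allᵇ? λ e → P.exact? (Action.θ D5-action (b ∷ [] , e)))

  abstract
    separated : P.Separated
    separated = from-yes P.separated?

  pairs : List (Fin 5 × Fin 5)
  pairs = (2F , 0F) ∷ (3F , 0F) ∷ []

  abstract
    rigid : ∀ t → Collision t ⊎ Realised D5-action (Inverse.to D5-elements) t ⊎ P.Rigid pairs (lookup t)
    rigid = from-yes (all-vec? 5 λ t → collision? t ⊎-dec realised? D5-action (Inverse.to D5-elements) t ⊎-dec P.rigid? pairs (lookup t))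

-- Transfer of the certificates to ℤ_p.

module Interpretation (p : ℕ) .{{p≢0 : NonZero p}} (pr : Prime p) (p≢5 : p ≢ 5) {d : ℕ} (r : Vec ℤ (suc d))
  (xs : List (Vec ℤ (suc d))) (x : Fin p) (root : Evaluation.eval p r x r ≡ Evaluation.pow p r x (suc d))
  {n : ℕ} (ŵ : Fin 5 → Vec (Vec ℤ (suc d)) n) (w : Fin 5 → Vec (Fin p) n) (bs : Fin n → Fin 5)
  (w-origin : w fzero ≡ Vectors.0ᵥ p) (w-basis : ∀ j → w (bs j) ≡ Vectors.unit p j)
  (ŵ-eval : ∀ i → map (Evaluation.eval p r x) (ŵ i) ≡ w i) where
  open Residues p using (-‿inverseʳ)
  open IntegerAlgebra r
  open Pentad r ŵ bs xs
  open Evaluation p r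
  open Configuration n p w bs w-origin w-basis
  open ≡-Reasoning

  private
    ev : ∀ {m} → Vec B m → V m
    ev = map (eval x)

  ev-difference : ∀ {m} (u v : Vec B m) → ev (zipWith _⊟_ u v) ≡ ev u ⊖ ev v
  ev-difference []      []      = refl
  ev-difference (a ∷ u) (b ∷ v) = cong₂ _∷_ (eval-⊟ x a b) (ev-difference u v)

  ev-+ : ∀ {m} (u v : Vec B m) → ev (zipWith _+ᴮ_ u v) ≡ ev u +ᵥ ev v
  ev-+ []      []      = refl
  ev-+ (a ∷ u) (b ∷ v) = cong₂ _∷_ (eval-+ x a b) (ev-+ u v)

  ev-residual : ∀ π i → ev (residual π i) ≡ (L π (w i) +ᵥ w (π 0F)) ⊖ w (π i)
  ev-residual π i = begin
    ev (residual π i)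
      ≡⟨ ev-difference _ (ŵ (π i)) ⟩
    ev (zipWith _+ᴮ_ (linᴮ f̂ (ŵ i)) (ŵ (π 0F))) ⊖ ev (ŵ (π i))
      ≡⟨ cong₂ _⊖_ (trans (ev-+ (linᴮ f̂ (ŵ i)) (ŵ (π 0F))) (cong₂ _+ᵥ_ (eval-lin x root f̂ (ŵ i)) (ŵ-eval (π 0F)))) (ŵ-eval (π i)) ⟩
    (lin (ev ∘ f̂) (ev (ŵ i)) +ᵥ w (π 0F)) ⊖ w (π i)
      ≡⟨ cong (λ u → (u +ᵥ w (π 0F)) ⊖ w (π i)) (trans (lin-cong frames (ev (ŵ i))) (cong (L π) (ŵ-eval i))) ⟩
    (L π (w i) +ᵥ w (π 0F)) ⊖ w (π i) ∎
    where
    f̂ : Fin n → Vec B n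
    f̂ j = difference (ŵ (π (bs j))) (ŵ (π 0F))
    frames : ∀ j → ev (f̂ j) ≡ frame π j
    frames j = trans (ev-difference (ŵ (π (bs j))) (ŵ (π 0F))) (cong₂ _⊖_ (ŵ-eval (π (bs j))) (ŵ-eval (π 0F)))

  -- A residual that vanishes in the exact ring also vanishes after evaluation.
  exact⇒admissible : ∀ {π} → Exact π → Admissible π
  exact⇒admissible {π} exact i = begin
    X                         ≡⟨ ⊖-+ᵥ-cancel X (w (π i)) ⟨
    (X ⊖ w (π i)) +ᵥ w (π i)  ≡⟨ cong (_+ᵥ w (π i)) (trans (sym (ev-residual π i)) (trans (cong ev (exact i)) ev-0)) ⟩
    0ᵥ +ᵥ w (π i)             ≡⟨ +ᵥ-identityˡ (w (π i)) ⟩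
    w (π i)                   ∎
    where
    X = L π (w i) +ᵥ w (π 0F)
    ev-0 : ev (replicate n 0ᴮ) ≡ 0ᵥ
    ev-0 = trans (Vecₚ.map-replicate (eval x) 0ᴮ n) (cong (replicate n) (eval-0 x (suc d)))

  distinct⇒≢ : ∀ {m} (u v : Vec B m) → VecAny.Any (UnitAwayFrom5 xs) (zipWith _⊟_ u v) → ev u ≢ ev v
  distinct⇒≢ (a ∷ u) (b ∷ v) (VecAny.here a-b-unit) eq = unit⇒≢0 x root pr p≢5 xs (a ⊟ b) a-b-unit
    (trans (eval-⊟ x a b) (trans (cong (λ t → addZ p t (negZ p (eval x b))) (Vecₚ.∷-injectiveˡ eq)) (-‿inverseʳ (eval x b))))
  distinct⇒≢ (a ∷ u) (b ∷ v) (VecAny.there distinct) eq = distinct⇒≢ u v distinct (Vecₚ.∷-injectiveʳ eq)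

  separated⇒injective : Separated → Injective _≡_ _≡_ w
  separated⇒injective separated {i} {j} wi≡wj = [ id , (λ distinct → contradiction
    (trans (ŵ-eval i) (trans wi≡wj (sym (ŵ-eval j)))) (distinct⇒≢ (ŵ i) (ŵ j) distinct)) ]′ (separated i j)

  rigid⇒¬admissible : ∀ {pairs π} → Rigid pairs π → ¬ Admissible π
  rigid⇒¬admissible {π = π} (here {x = (i , j)} distinct) adm =
    distinct⇒≢ (residual π i) (residual π j) distinct (trans (vanish i) (sym (vanish j)))
    where
    vanish : ∀ i → ev (residual π i) ≡ 0ᵥ
    vanish i = trans (ev-residual π i) (trans (cong (_⊖ w (π i)) (adm i)) (+ᵥ-inverseʳ (w (π i))))
  rigid⇒¬admissible (there rigid) adm = rigid⇒¬admissible rigid adm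

-- The four point sets, and the two cases with p = 5.

module _ (p : ℕ) .{{p≢0 : NonZero p}} where

  -- The exponents are spelled as in the graphs, so that the list `S` of each configuration is the
  -- given connection set by computation.
  w₁ w₂ : ℕ → Fin 5 → Vec (Fin p) 2
  w₁ ℓ = lookup ((zp p 0 ∷ zp p 0 ∷ []) ∷ (zp p 1 ∷ zp p 0 ∷ []) ∷
    (zp p (ℓ ℕ.* invℕ p (ℓ ℕ.+ 1)) ∷ zp p (invℕ p ℓ) ∷ []) ∷ (zp p ℓ ∷ zp p (invℕ p (ℓ ℕ.+ 1)) ∷ []) ∷
    (zp p 0 ∷ zp p 1 ∷ []) ∷ [])
  w₂ g = lookup ((zp p 0 ∷ zp p 0 ∷ []) ∷ (zp p 1 ∷ zp p 0 ∷ []) ∷ (zp p g ∷ zp p 1 ∷ []) ∷ (zp p 1 ∷ zp p g ∷ []) ∷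
    (zp p 0 ∷ zp p 1 ∷ []) ∷ [])

  w₃ : ℕ → Fin 5 → Vec (Fin p) 3
  w₃ ℓ = lookup ((zp p 0 ∷ zp p 0 ∷ zp p 0 ∷ []) ∷ (zp p 1 ∷ zp p 0 ∷ zp p 0 ∷ []) ∷ (zp p 0 ∷ zp p 1 ∷ zp p 0 ∷ []) ∷
    (zp p (negℕ p (ℓ ^ 2)) ∷ zp p (negℕ p ℓ) ∷ zp p (negℕ p (invℕ p ℓ)) ∷ []) ∷ (zp p 0 ∷ zp p 0 ∷ zp p 1 ∷ []) ∷ [])

  w₄ : Fin 5 → Vec (Fin p) 4
  w₄ = lookup ((zp p 0 ∷ zp p 0 ∷ zp p 0 ∷ zp p 0 ∷ []) ∷ (zp p 1 ∷ zp p 0 ∷ zp p 0 ∷ zp p 0 ∷ []) ∷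
    (zp p 0 ∷ zp p 1 ∷ zp p 0 ∷ zp p 0 ∷ []) ∷ (zp p 0 ∷ zp p 0 ∷ zp p 1 ∷ zp p 0 ∷ []) ∷
    (zp p 0 ∷ zp p 0 ∷ zp p 0 ∷ zp p 1 ∷ []) ∷ [])

module Part1-5 where
  open Cyclotomic using (basis₁)

  F20-elements : Fin 20 ↔ (Fin 5 × Fin 4)
  F20-elements = *↔×

  w-basis : ∀ j → w₁ 5 1 (basis₁ j) ≡ Vectors.unit 5 j
  w-basis = λ { 0F → refl ; 1F → refl }

  w-injective : Injective _≡_ _≡_ (w₁ 5 1)
  w-injective {i} {j} = from-yes (all? λ i → all? λ j → Vecₚ.≡-dec _≟ᶠ_ (w₁ 5 1 i) (w₁ 5 1 j) →-dec (i ≟ᶠ j)) i j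

  open Symmetries 2 5 (w₁ 5 1) basis₁ refl w-basis w-injective F20-action public

  -- Here `w i` has first minus second coordinate i and coordinate sum i², so the points form a
  -- parabola, on which every i ↦ ki + b acts affinely.
  admissible : ∀ x → Admissible (Action.θ F20-action x)
  admissible (b , k) = from-yes (all? λ b → all? λ k → admissible? (Action.θ F20-action (b , k))) b k

  complete : Complete
  complete = complete-by-tables (Inverse.to F20-elements) (from-yes (all-vec? 5 λ t →
    collision? t ⊎-dec realised? F20-action (Inverse.to F20-elements) t ⊎-dec ¬? (admissible? (lookup t))))

module Part3-5 where
  open Cyclotomic using (basis₃)

  w-basis : ∀ j → w₃ 5 1 (basis₃ j) ≡ Vectors.unit 5 j
  w-basis = λ { 0F → refl ; 1F → refl ; 2F → refl }

  w-injective : Injective _≡_ _≡_ (w₃ 5 1)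
  w-injective {i} {j} = from-yes (all? λ i → all? λ j → Vecₚ.≡-dec _≟ᶠ_ (w₃ 5 1 i) (w₃ 5 1 j) →-dec (i ≟ᶠ j)) i j

  open Symmetries 3 5 (w₃ 5 1) basis₃ refl w-basis w-injective S5-action public

  abstract
    -- With ℓ = 1 the five points sum to 0, and 5 = 0 in ℤ_5, so their affine relation has equal
    -- coefficients and is invariant under all permutations.
    all-admissible : ∀ t → Collision t ⊎ Admissible (lookup t)
    all-admissible = from-yes (all-vec? 5 λ t → collision? t ⊎-dec admissible? (lookup t))

  admissible : ∀ σ → Admissible (app σ)
  admissible σ = [ (λ (i , j , i≢j , eq) → contradiction (↔-injective σ (trans (sym (look i)) (trans eq (look j)))) i≢j)
                 , Admissible-resp look ]′ (all-admissible (tabulate (app σ)))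
    where
    look : ∀ i → lookup (tabulate (app σ)) i ≡ app σ i
    look = Vecₚ.lookup∘tabulate (app σ)

S5-complete : ∀ {P : (Fin 5 → Fin 5) → Set} π → Injective _≡_ _≡_ π → P π → ∃ λ σ → ∀ i → π i ≡ app σ i
S5-complete π π-injective _ = injective⇒↔ π-injective , λ _ → refl

pair : ∀ {A : Set} {a a' b b' : A} → a ≡ a' → b ≡ b' → _≡_ {A = Vec A 2} (a ∷ b ∷ []) (a' ∷ b' ∷ [])
pair refl refl = refl

triple : ∀ {A : Set} {a a' b b' c c' : A} → a ≡ a' → b ≡ b' → c ≡ c' → _≡_ {A = Vec A 3} (a ∷ b ∷ c ∷ []) (a' ∷ b' ∷ c' ∷ [])
triple refl refl refl = refl

-- The graphs of orders 2p² and 2p³ defined by a fifth root of unity.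

module FifthRoot (p : ℕ) .{{p≢0 : NonZero p}} (pr : Prime p) (ℓ : ℕ) (5∣p-1 : 5 ∣ p ∸ 1)
  (ℓ^5≡1 : (ℓ ^ 5) % p ≡ 1) (ℓ≢1 : ¬ (ℓ % p ≡ 1)) where
  open Residues p
  open Cyclotomic
  open Evaluation p r
  open IntegerAlgebra r using (const; _*ᴮ_; push)
  open ≡-Reasoning

  x : Fin p
  x = zp p ℓ

  p≢5 : p ≢ 5
  p≢5 refl = contradiction (∣⇒≤ 5∣p-1) (ℕₚ.<⇒≱ (ℕₚ.n<1+n 4))

  1%p≡1 : 1 % p ≡ 1
  1%p≡1 = m<n⇒m%n≡m (ℕ.nonTrivial⇒n>1 p {{prime⇒nonTrivial pr}})

  pow-zp : ∀ k → pow x k ≡ zp p (ℓ ^ k)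
  pow-zp zero    = refl
  pow-zp (suc k) = trans (cong (x ⊗_) (pow-zp k)) (zp-* ℓ (ℓ ^ k))

  ones : ∀ k → Vec ℤ k
  ones k = replicate k 1ℤ

  push-ones : ∀ k → push 1ℤ (ones k) ≡ (ones k , 1ℤ)
  push-ones zero    = refl
  push-ones (suc k) = cong (λ (v , c) → 1ℤ ∷ v , c) (push-ones k)

  -- The case of `eval-push` with all coefficients 1, where pushing a 1 reproduces the list and
  -- overflows a 1.
  geometric : ∀ k → eval x (ones k) ⊕ pow x k ≡ zp p 1 ⊕ x ⊗ eval x (ones k)
  geometric k = trans (cong (eval x (ones k) ⊕_) (sym (⊗-identityˡ (pow x k))))
    (subst (λ (v , c) → eval x v ⊕ ι c ⊗ pow x k ≡ zp p 1 ⊕ x ⊗ eval x (ones k)) (push-ones k) (eval-push x 1ℤ (ones k)))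

  -- Σ = 1 + x + … + x⁴ satisfies x Σ = Σ, and x ≠ 1.
  Σ≡0 : eval x (ones 5) ≡ zp p 0
  Σ≡0 with eval x (ones 5) ≟ᶠ zp p 0
  ... | yes eq  = eq
  ... | no Σ≢0 = contradiction (trans (zp-injective x≡1) 1%p≡1) ℓ≢1
    where
    Σx = eval x (ones 5)
    xΣ≡Σ : Σx ⊗ x ≡ Σx ⊗ zp p 1
    xΣ≡Σ = +-cancelˡ (zp p 1) (Σx ⊗ x) (Σx ⊗ zp p 1) (begin
      zp p 1 ⊕ Σx ⊗ x         ≡⟨ cong (zp p 1 ⊕_) (⊗-comm Σx x) ⟩
      zp p 1 ⊕ x ⊗ Σx         ≡⟨ geometric 5 ⟨
      Σx ⊕ pow x 5            ≡⟨ cong (Σx ⊕_) (trans (pow-zp 5) (zp-cong (trans ℓ^5≡1 (sym 1%p≡1)))) ⟩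
      Σx ⊕ zp p 1             ≡⟨ ⊕-comm Σx (zp p 1) ⟩
      zp p 1 ⊕ Σx             ≡⟨ cong (zp p 1 ⊕_) (*-identityʳ Σx) ⟨
      zp p 1 ⊕ Σx ⊗ zp p 1    ∎)
    x≡1 : x ≡ zp p 1
    x≡1 = ⊗-cancelˡ pr Σx Σ≢0 xΣ≡Σ

  -- As `r` is minus the all-ones vector, this is the relation 1 + x + ... + x⁴ = 0 solved for x⁴.
  root : eval x r ≡ pow x 4
  root = trans (eval-neg x (ones 4)) (+-cancelˡ E (negZ p E) (pow x 4)
    (trans (-‿inverseʳ E) (sym (trans (geometric 4) Σ≡0))))
    where E = eval x (ones 4)

  -- Uniqueness of inverses identifies an inverse in ℤ[ζ] with the Fermat power `invℕ p k`. The
  -- product being 1 also shows that `k` is nonzero modulo p, for instance that ℓ + 1 is.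
  eval-inverse : ∀ (a b : Vec ℤ 4) k → a *ᴮ b ≡ const 1ℤ → eval x a ≡ zp p k → eval x b ≡ zp p (invℕ p k)
  eval-inverse a b k ab≡1 a≡k = ⊗-cancelˡ pr (zp p k) k≢0 (trans kb≡1 (sym (invℕ-inverse p pr k k≢0)))
    where
    kb≡1 : zp p k ⊗ eval x b ≡ zp p 1
    kb≡1 = begin
      zp p k ⊗ eval x b       ≡⟨ cong (_⊗ eval x b) a≡k ⟨
      eval x a ⊗ eval x b     ≡⟨ eval-* x root a b ⟨
      eval x (a *ᴮ b)         ≡⟨ cong (eval x) ab≡1 ⟩
      eval x (const 1ℤ)       ≡⟨ eval-const x 1ℤ 3 ⟩
      zp p 1                  ∎
    k≢0 : zp p k ≢ zp p 0
    k≢0 k≡0 = 1≢0 pr (trans (sym kb≡1) (trans (cong (_⊗ eval x b) k≡0) (zeroˡ (eval x b))))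

  eval-linear : ∀ a → eval x (a ∷ 1ℤ ∷ 0ℤ ∷ 0ℤ ∷ []) ≡ ι a ⊕ x
  eval-linear a = cong (ι a ⊕_) (trans (cong (x ⊗_) (eval-const x 1ℤ 2)) (*-identityʳ x))

  eval-ζ : eval x ζ ≡ zp p ℓ
  eval-ζ = trans (eval-linear 0ℤ) (⊕-identityˡ x)

  eval-1+ζ : eval x 1+ζ ≡ zp p (ℓ ℕ.+ 1)
  eval-1+ζ = trans (eval-linear 1ℤ) (trans (⊕-comm (zp p 1) x) (zp-+ ℓ 1))

  eval-ζ⁻¹ : eval x ζ⁻¹ ≡ zp p (invℕ p ℓ)
  eval-ζ⁻¹ = eval-inverse ζ ζ⁻¹ ℓ refl eval-ζ

  eval-[1+ζ]⁻¹ : eval x [1+ζ]⁻¹ ≡ zp p (invℕ p (ℓ ℕ.+ 1))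
  eval-[1+ζ]⁻¹ = eval-inverse 1+ζ [1+ζ]⁻¹ (ℓ ℕ.+ 1) refl eval-1+ζ

  eval-product : ∀ (a b : Vec ℤ 4) {j k} → eval x a ≡ zp p j → eval x b ≡ zp p k → eval x (a *ᴮ b) ≡ zp p (j ℕ.* k)
  eval-product a b {j} {k} a≡j b≡k = trans (eval-* x root a b) (trans (cong₂ _⊗_ a≡j b≡k) (zp-* j k))

  eval-negative : ∀ (a : Vec ℤ 4) k → eval x a ≡ zp p k → eval x (map ℤ.-_ a) ≡ zp p (negℕ p k)
  eval-negative a k a≡k = trans (eval-neg x a) (trans (cong (negZ p) a≡k) (cong (λ m → zp p (p ∸ m)) (toℕ-zp k)))

  eval-0ᴮ : eval x (replicate 4 0ℤ) ≡ zp p 0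
  eval-0ᴮ = eval-0 x 4

  eval-1ᴮ : eval x (const 1ℤ) ≡ zp p 1
  eval-1ᴮ = eval-const x 1ℤ 3

  module GD₁ where
    points-eval : ∀ i → map (eval x) (lookup points₁ i) ≡ w₁ p ℓ i
    points-eval 0F = pair eval-0ᴮ eval-0ᴮ
    points-eval 1F = pair eval-1ᴮ eval-0ᴮ
    points-eval 2F = pair (eval-product ζ [1+ζ]⁻¹ eval-ζ eval-[1+ζ]⁻¹) eval-ζ⁻¹
    points-eval 3F = pair eval-ζ eval-[1+ζ]⁻¹
    points-eval 4F = pair eval-0ᴮ eval-1ᴮ

    w-basis : ∀ j → w₁ p ℓ (basis₁ j) ≡ Vectors.unit p j
    w-basis 0F = refl
    w-basis 1F = refl

    open Interpretation p pr p≢5 r conjugates x root (lookup points₁) (w₁ p ℓ) basis₁ refl w-basis points-eval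
    open Symmetries 2 p (w₁ p ℓ) basis₁ refl w-basis (separated⇒injective separated₁) Z5-action public

    admissible : ∀ b → Admissible (Action.θ Z5-action b)
    admissible b = exact⇒admissible {Action.θ Z5-action b} (exact₁ b)

    complete : Complete
    complete = complete-by-tables id λ t → Sum.map₂ (Sum.map₂ (rigid⇒¬admissible {pairs₁} {lookup t})) (rigid₁ t)

  module GD₃ where
    points-eval : ∀ i → map (eval x) (lookup points₃ i) ≡ w₃ p ℓ i
    points-eval 0F = triple eval-0ᴮ eval-0ᴮ eval-0ᴮ
    points-eval 1F = triple eval-1ᴮ eval-0ᴮ eval-0ᴮ
    points-eval 2F = triple eval-0ᴮ eval-1ᴮ eval-0ᴮ
    points-eval 3F = triple
      -- `ℓ ^ 2` unfolds to `ℓ * (ℓ * 1)`, hence the correction by the right identity.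
      (eval-negative (ζ *ᴮ ζ) (ℓ ^ 2) (trans (eval-product ζ ζ eval-ζ eval-ζ) (cong (λ m → zp p (ℓ ℕ.* m)) (sym (ℕₚ.*-identityʳ ℓ)))))
      (eval-negative ζ ℓ eval-ζ)
      (eval-negative ζ⁻¹ (invℕ p ℓ) eval-ζ⁻¹)
    points-eval 4F = triple eval-0ᴮ eval-0ᴮ eval-1ᴮ

    w-basis : ∀ j → w₃ p ℓ (basis₃ j) ≡ Vectors.unit p j
    w-basis 0F = refl
    w-basis 1F = refl
    w-basis 2F = refl

    open Interpretation p pr p≢5 r conjugates x root (lookup points₃) (w₃ p ℓ) basis₃ refl w-basis points-eval
    open Symmetries 3 p (w₃ p ℓ) basis₃ refl w-basis (separated⇒injective separated₃) Z5-action public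

    admissible : ∀ b → Admissible (Action.θ Z5-action b)
    admissible b = exact⇒admissible {Action.θ Z5-action b} (exact₃ b)

-- The graph of order 2p² defined by a square root of 5.

module GoldenRatio (p : ℕ) .{{p≢0 : NonZero p}} (pr : Prime p) (λ′ : ℕ) (valid : ValidLambda p λ′) where
  open Residues p
  open Golden
  open Evaluation p r
  open IntegerAlgebra r using (const)
  open ≡-Reasoning

  excluded : ∀ q → ¬ (5 ∣ q ∸ 1) → ¬ (5 ∣ q ℕ.+ 1) → p ≢ q
  excluded q 5∤q-1 5∤q+1 refl = [ 5∤q-1 , 5∤q+1 ]′ (proj₁ valid)

  p≢5 : p ≢ 5
  p≢5 = excluded 5 (from-no (5 ∣? 4)) (from-no (5 ∣? 6))

  -- The exponent (1 + λ)/2 of the connection set, a golden ratio modulo p.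
  g : ℕ
  g = invℕ p 2 ℕ.* (1 ℕ.+ λ′)

  x : Fin p
  x = zp p g

  2≢0 : zp p 2 ≢ zp p 0
  2≢0 eq = [ (λ p≡1 → ¬prime[1] (subst Prime p≡1 pr)) , excluded 2 (from-no (5 ∣? 1)) (from-no (5 ∣? 3)) ]′
    (prime⇒irreducible prime[2] (zp≡0⇒∣ eq))

  2x : zp p 2 ⊗ x ≡ zp p (1 ℕ.+ λ′)
  2x = begin
    zp p 2 ⊗ zp p (invℕ p 2 ℕ.* (1 ℕ.+ λ′))            ≡⟨ cong (zp p 2 ⊗_) (zp-* (invℕ p 2) (1 ℕ.+ λ′)) ⟨
    zp p 2 ⊗ (zp p (invℕ p 2) ⊗ zp p (1 ℕ.+ λ′))       ≡⟨ ⊗-assoc (zp p 2) (zp p (invℕ p 2)) (zp p (1 ℕ.+ λ′)) ⟨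
    (zp p 2 ⊗ zp p (invℕ p 2)) ⊗ zp p (1 ℕ.+ λ′)       ≡⟨ cong (_⊗ zp p (1 ℕ.+ λ′)) (invℕ-inverse p pr 2 2≢0) ⟩
    zp p 1 ⊗ zp p (1 ℕ.+ λ′)                           ≡⟨ ⊗-identityˡ _ ⟩
    zp p (1 ℕ.+ λ′)                                    ∎

  -- 4 x² = (1 + λ)² = 6 + 2 λ = 4 (1 + x)
  x²≡1+x : x ⊗ x ≡ zp p 1 ⊕ x
  x²≡1+x = ⊗-cancelˡ pr two 2≢0 (⊗-cancelˡ pr two 2≢0 (begin
    two ⊗ (two ⊗ (x ⊗ x))                              ≡⟨ cong (two ⊗_) (⊗-assoc two x x) ⟨
    two ⊗ ((two ⊗ x) ⊗ x)                              ≡⟨ cong (two ⊗_) (⊗-comm (two ⊗ x) x) ⟩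
    two ⊗ (x ⊗ (two ⊗ x))                              ≡⟨ ⊗-assoc two x (two ⊗ x) ⟨
    (two ⊗ x) ⊗ (two ⊗ x)                              ≡⟨ cong₂ _⊗_ 2x 2x ⟩
    zp p (1 ℕ.+ λ′) ⊗ zp p (1 ℕ.+ λ′)                  ≡⟨ zp-* (1 ℕ.+ λ′) (1 ℕ.+ λ′) ⟩
    zp p ((1 ℕ.+ λ′) ℕ.* (1 ℕ.+ λ′))                   ≡⟨ cong (zp p) (square λ′) ⟩
    zp p (1 ℕ.+ 2 ℕ.* λ′ ℕ.+ λ′ ^ 2)                   ≡⟨ zp-+ (1 ℕ.+ 2 ℕ.* λ′) (λ′ ^ 2) ⟨
    zp p (1 ℕ.+ 2 ℕ.* λ′) ⊕ zp p (λ′ ^ 2)              ≡⟨ cong (zp p (1 ℕ.+ 2 ℕ.* λ′) ⊕_) (zp-cong (proj₁ (proj₂ valid))) ⟩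
    zp p (1 ℕ.+ 2 ℕ.* λ′) ⊕ zp p 5                     ≡⟨ zp-+ (1 ℕ.+ 2 ℕ.* λ′) 5 ⟩
    zp p (1 ℕ.+ 2 ℕ.* λ′ ℕ.+ 5)                        ≡⟨ cong (zp p) (regroup λ′) ⟩
    zp p (2 ℕ.* 2 ℕ.+ 2 ℕ.* (1 ℕ.+ λ′))                ≡⟨ zp-+ (2 ℕ.* 2) (2 ℕ.* (1 ℕ.+ λ′)) ⟨
    zp p (2 ℕ.* 2) ⊕ zp p (2 ℕ.* (1 ℕ.+ λ′))           ≡⟨ cong₂ _⊕_ (zp-* 2 2) (zp-* 2 (1 ℕ.+ λ′)) ⟨
    two ⊗ two ⊕ two ⊗ zp p (1 ℕ.+ λ′)                  ≡⟨ cong (λ t → two ⊗ two ⊕ two ⊗ t) 2x ⟨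
    two ⊗ two ⊕ two ⊗ (two ⊗ x)                        ≡⟨ ⊗-distribˡ-⊕ two two (two ⊗ x) ⟨
    two ⊗ (two ⊕ two ⊗ x)                              ≡⟨ cong (λ t → two ⊗ (t ⊕ two ⊗ x)) (*-identityʳ two) ⟨
    two ⊗ (two ⊗ zp p 1 ⊕ two ⊗ x)                     ≡⟨ cong (two ⊗_) (⊗-distribˡ-⊕ two (zp p 1) x) ⟨
    two ⊗ (two ⊗ (zp p 1 ⊕ x))                         ∎))
    where
    two = zp p 2
    square : ∀ n → (1 ℕ.+ n) ℕ.* (1 ℕ.+ n) ≡ 1 ℕ.+ 2 ℕ.* n ℕ.+ n ℕ.* (n ℕ.* 1)
    square = ℕSolver.solve-∀
    regroup : ∀ n → 1 ℕ.+ 2 ℕ.* n ℕ.+ 5 ≡ 4 ℕ.+ 2 ℕ.* (1 ℕ.+ n)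
    regroup = ℕSolver.solve-∀

  eval-φ′ : ∀ a → eval x (a ∷ 1ℤ ∷ []) ≡ ι a ⊕ x
  eval-φ′ a = cong (ι a ⊕_) (trans (cong (x ⊗_) (eval-const x 1ℤ 0)) (*-identityʳ x))

  root : eval x r ≡ pow x 2
  root = trans (eval-φ′ 1ℤ) (trans (sym x²≡1+x) (cong (x ⊗_) (sym (*-identityʳ x))))

  eval-φ : eval x φ ≡ x
  eval-φ = trans (eval-φ′ 0ℤ) (⊕-identityˡ x)

  eval-0ᴮ : eval x (replicate 2 0ℤ) ≡ zp p 0
  eval-0ᴮ = eval-0 x 2

  eval-1ᴮ : eval x (const 1ℤ) ≡ zp p 1
  eval-1ᴮ = eval-const x 1ℤ 1

  points-eval : ∀ i → map (eval x) (lookup points i) ≡ w₂ p g i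
  points-eval 0F = pair eval-0ᴮ eval-0ᴮ
  points-eval 1F = pair eval-1ᴮ eval-0ᴮ
  points-eval 2F = pair eval-φ eval-1ᴮ
  points-eval 3F = pair eval-1ᴮ eval-φ
  points-eval 4F = pair eval-0ᴮ eval-1ᴮ

  w-basis : ∀ j → w₂ p g (basis j) ≡ Vectors.unit p j
  w-basis 0F = refl
  w-basis 1F = refl

  open Interpretation p pr p≢5 r conjugates x root (lookup points) (w₂ p g) basis refl w-basis points-eval
  open Symmetries 2 p (w₂ p g) basis refl w-basis (separated⇒injective separated) D5-action public

  admissible : ∀ y → Admissible (Action.θ D5-action y)
  admissible (b ∷ [] , e) = exact⇒admissible {Action.θ D5-action (b ∷ [] , e)} (exact b e)

  complete : Complete
  complete = complete-by-tables (Inverse.to D5-elements) λ t →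
    Sum.map₂ (Sum.map₂ (rigid⇒¬admissible {pairs} {lookup t})) (rigid t)

-- The graph of order 2p⁴.

module Simplex (p : ℕ) .{{p≢0 : NonZero p}} (pr : Prime p) where
  open Vectors p using (unit; unit≢0; unit-injective; additive-0; lin-unit; lin-additive; +ᵥ-identityˡ; ⊖-+ᵥ-cancel; _+ᵥ_)

  w-basis : ∀ j → w₄ p (fsuc j) ≡ unit j
  w-basis 0F = refl
  w-basis 1F = refl
  w-basis 2F = refl
  w-basis 3F = refl

  w-injective : Injective _≡_ _≡_ (w₄ p)
  w-injective {fzero}  {fzero}  eq = refl
  w-injective {fzero}  {fsuc j} eq = contradiction (trans (sym (w-basis j)) (sym eq)) (unit≢0 pr j)
  w-injective {fsuc i} {fzero}  eq = contradiction (trans (sym (w-basis i)) eq) (unit≢0 pr i)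
  w-injective {fsuc i} {fsuc j} eq = cong fsuc (unit-injective pr (trans (sym (w-basis i)) (trans eq (w-basis j))))

  open Symmetries 4 p (w₄ p) fsuc refl w-basis w-injective S5-action public
    hiding (unit; unit≢0; unit-injective; additive-0; lin-unit; lin-additive; +ᵥ-identityˡ; ⊖-+ᵥ-cancel; _+ᵥ_)

  -- The five points are an affine basis, so `L` is defined by exactly the equations to be checked.
  admissible : ∀ σ → Admissible (app σ)
  admissible σ fzero    = trans (cong (_+ᵥ w₄ p (app σ 0F)) (additive-0 (L-additive (app σ)))) (+ᵥ-identityˡ (w₄ p (app σ 0F)))
  admissible σ (fsuc j) = trans
    (cong (_+ᵥ w₄ p (app σ 0F)) (trans (cong (L (app σ)) (w-basis j)) (lin-unit (frame (app σ)) j)))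
    (⊖-+ᵥ-cancel (w₄ p (app σ (fsuc j))) (w₄ p (app σ 0F)))

-- The four assertions.

part1 : Part1
part1 p pr ℓ (inj₁ (refl , refl)) =
    normalArcTransitive admissible pr F20-transitive , (λ _ → isSemidirect admissible complete) ,
    (λ 5∣4 → contradiction 5∣4 (from-no (5 ∣? 4))) ,
    -- For p = 5 the normaliser has order 20 · 2 · 25 = 1000, whereas 20 · 25 = 500.
    λ P sylow |N| → contradiction
      (size-unique |N| (normalizer-size admissible complete F20-elements id pr P sylow)) λ ()
  where open Part1-5
part1 p pr ℓ (inj₂ (5∣p-1 , ℓ^5≡1 , ℓ≢1)) =
    normalArcTransitive admissible pr Z5-transitive , (λ p≡5 → contradiction p≡5 p≢5) ,
    (λ _ → isSemidirect admissible complete) ,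
    -- The normaliser has order 5 · 2p² = 10p²; cancelling p² from the supposed equality would give
    -- 20 = 10.
    λ P sylow |N| → contradiction
      (ℕₚ.*-cancelʳ-≡ 20 10 (p ^ 2) {{ℕₚ.m^n≢0 p 2}}
        (trans (size-unique |N| (normalizer-size admissible complete (↔-id (Fin 5)) id pr P sylow)) (count (p ^ 2)))) λ ()
  where
  open FifthRoot p pr ℓ 5∣p-1 ℓ^5≡1 ℓ≢1
  open GD₁
  count : ∀ q → 5 ℕ.* (q ℕ.* 2) ≡ 10 ℕ.* q
  count = ℕSolver.solve-∀

part2 : Part2
part2 p pr λ′ valid =
    normalArcTransitive admissible pr D5-transitive , isSemidirect admissible complete ,
    -- The order is 10 · 2p², which is exactly 20p².
    λ P sylow → 10 ℕ.* (p ^ 2 ℕ.* 2) , normalizer-size admissible complete D5-elements id pr P sylow ,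
      divides 1 (count (p ^ 2))
  where
  open Golden using (D5-elements)
  open GoldenRatio p pr λ′ valid
  count : ∀ q → 10 ℕ.* (q ℕ.* 2) ≡ 1 ℕ.* (20 ℕ.* q)
  count = ℕSolver.solve-∀

part3 : Part3
part3 p pr ℓ (inj₁ (refl , refl)) =
    normalArcTransitive admissible pr S5-transitive , (λ _ → isSemidirect admissible S5-complete) ,
    (λ 5∣4 → contradiction 5∣4 (from-no (5 ∣? 4)))
  where open Part3-5
part3 p pr ℓ (inj₂ (5∣p-1 , ℓ^5≡1 , ℓ≢1)) =
    normalArcTransitive admissible pr Z5-transitive , (λ p≡5 → contradiction p≡5 p≢5) ,
    (λ _ → containsSemidirect admissible)
  where
  open FifthRoot p pr ℓ 5∣p-1 ℓ^5≡1 ℓ≢1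
  open GD₃

part4 : Part4
part4 p pr = normalArcTransitive admissible pr S5-transitive , isSemidirect admissible S5-complete
  where open Simplex p pr

theorem3p1 : Part1 × Part2 × Part3 × Part4
theorem3p1 = part1 , part2 , part3 , part4
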